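{- Let $m$ and $n$ be relatively prime positive integers. Then $S(A_m \otimes A_n) = S(A_{mn})$, where $\otimes$ denotes the Kronecker product of matrices.
   Context: For a positive integer $k$, let $\Phi_d$ denote the $d$th cyclotomic polynomial and let $\Psi_k : \mathbf{Z}[X]/(X^k-1) \to \bigoplus_{d \mid k} \mathbf{Z}[X]/(\Phi_d(X))$ be the natural map $f \bmod (X^k-1) \mapsto \bigoplus_{d\mid k} f \bmod \Phi_d(X)$. Endow $\mathbf{Z}[X]/(X^k-1)$ with the basis $(1, \overline{X}, \dots, \overline{X}^{k-1})$, each $\mathbf{Z}[X]/(\Phi_d(X))$ with the basis $(1, \overline{X}, \dots, \overline{X}^{\phi(d)-1})$, and order the summands of the direct sum by increasing $d$. $A_k$ is the $k\times k$ integer matrix of $\Psi_k$ with respect to these bases (the $j$th column is the coordinate vector of $\Psi_k(\overline{X}^{j})$). For an integer matrix $A$, $S(A)$ denotes its Smith normal form, with all elementary divisors taken non-negative. -}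

module Defs where

open import Algebra.Properties.Semiring.Sum using (sum)
open import Data.Bool.Base using (if_then_else_)
open import Data.Fin.Base using (Fin; toℕ; remQuot)
import Data.Fin.Properties as Fin
open import Data.Integer.Base using (ℤ; _+_; _*_; _-_; _≤_; 0ℤ; 1ℤ; -1ℤ)
open import Data.Integer.Divisibility using (_∣_)
open import Data.Integer.Properties using (+-*-semiring)
open import Data.List.Base as List using (List; []; _∷_; _∷ʳ_; length; map; filter; foldr; concatMap; take; upTo)
open import Data.Nat.Base as ℕ using (ℕ; zero; suc; pred; _∸_)
open import Data.Nat.Coprimality using (coprime?)
import Data.Nat.Divisibility as ℕ
open import Data.Product.Base using (∃-syntax; _×_; _,_; proj₁; proj₂)
open import Data.Vec.Base as Vec using (Vec; []; _∷_)
open import Relation.Binary.PropositionalEquality.Core using (_≡_; _≢_)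
open import Relation.Nullary.Decidable.Core using (does)

infixl 6 _+ₚ_
infixl 7 _*ₚ_ _·_ _⊗_
infix  4 _≈_

range : ℕ → List ℕ
range n = map suc (upTo n)

divisors : ℕ → List ℕ
divisors k = filter (ℕ._∣? k) (range k)

φ : ℕ → ℕ
φ d = length (filter (λ i → coprime? i d) (range d))

-- The list a₀ ∷ a₁ ∷ … ∷ aₑ ∷ [] is the polynomial a₀ + a₁X + … + aₑXᵉ.
Poly : Set
Poly = List ℤ

coeff : Poly → ℕ → ℤ
coeff []      _       = 0ℤ
coeff (a ∷ _) zero    = a
coeff (_ ∷ f) (suc i) = coeff f i

_+ₚ_ : Poly → Poly → Poly
[]      +ₚ g       = g
(a ∷ f) +ₚ []      = a ∷ f
(a ∷ f) +ₚ (b ∷ g) = (a + b) ∷ (f +ₚ g)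

_*ₚ_ : Poly → Poly → Poly
[]      *ₚ g = []
(a ∷ f) *ₚ g = map (a *_) g +ₚ (0ℤ ∷ f *ₚ g)

X^ : ℕ → Poly
X^ n = List.replicate n 0ℤ ∷ʳ 1ℤ

-- The degree when the last listed coefficient is nonzero; below it is applied
-- only to lists ending in 1.
deg : Poly → ℕ
deg p = pred (length p)

-- Division with remainder by the monic polynomial Xᵉ + Σ_{i<e} pᵢXⁱ, which is
-- given by its non-leading coefficients p.  If f = q·P + r and t is the
-- coefficient of Xᵉ in c + X·r, then
-- c + X·f = (t + X·q)·P + ((c + X·r) - t·P).
divModMonic : ∀ {e} → Vec ℤ e → Poly → Poly × Vec ℤ e
divModMonic {e} p []      = [] , Vec.replicate e 0ℤ
divModMonic {e} p (c ∷ f) =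
  let q , r = divModMonic p f
      s     = c ∷ r
      t     = Vec.last s
  in t ∷ q , Vec.zipWith (λ a b → a - t * b) (Vec.init s) p

-- In _div_ and _mod_ the divisor must be a list ending in 1.
lowerCoeffs : (p : Poly) → Vec ℤ (deg p)
lowerCoeffs p = Vec.tabulate (λ i → coeff p (toℕ i))

-- divModMonic pads the quotient with deg p leading zeros; they are dropped here.
_div_ : Poly → Poly → Poly
f div p = take (length f ∸ deg p) (proj₁ (divModMonic (lowerCoeffs p) f))

_mod_ : Poly → Poly → Poly
f mod p = Vec.toList (proj₂ (divModMonic (lowerCoeffs p) f))

-- Φₙ = (Xⁿ - 1) / ∏_{d∣n, d<n} Φ_d, where the Φ_d are taken from a list of
-- pairs (d , Φ_d) for d = 1, …, n - 1.
cyclotomicStep : ℕ → List (ℕ × Poly) → Poly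
cyclotomicStep n Φs =
  (X^ n +ₚ (-1ℤ ∷ [])) div
  foldr _*ₚ_ (1ℤ ∷ []) (map proj₂ (filter (λ dΦ → proj₁ dΦ ℕ.∣? n) Φs))

cyclotomics : ℕ → List (ℕ × Poly)
cyclotomics zero    = []
cyclotomics (suc n) =
  cyclotomics n ∷ʳ (suc n , cyclotomicStep (suc n) (cyclotomics n))

-- The d-th cyclotomic polynomial, for d ≥ 1.
Φ : ℕ → Poly
Φ d = cyclotomicStep d (cyclotomics (pred d))

-- Coordinates of the class of f in ℤ[X]/(Φ_d) with respect to 1, X, …, X^(φ(d)-1).
coords : (d : ℕ) → Poly → Vec ℤ (φ d)
coords d f = Vec.tabulate (λ i → coeff (f mod Φ d) (toℕ i))

-- Coordinates of Ψ_k(f) in ⨁_{d∣k} ℤ[X]/(Φ_d), summands ordered by increasing d.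
-- The list has length Σ_{d∣k} φ(d) = k.
Ψ : ℕ → Poly → List ℤ
Ψ k f = concatMap (λ d → Vec.toList (coords d f)) (divisors k)

Matrix : ℕ → ℕ → Set
Matrix r c = Fin r → Fin c → ℤ

_≈_ : ∀ {r c} → Matrix r c → Matrix r c → Set
M ≈ N = ∀ i j → M i j ≡ N i j

_·_ : ∀ {r s c} → Matrix r s → Matrix s c → Matrix r c
(M · N) i j = sum +-*-semiring (λ l → M i l * N l j)

𝟙 : ∀ {n} → Matrix n n
𝟙 i j = if does (i Fin.≟ j) then 1ℤ else 0ℤ

_⊗_ : ∀ {r c r′ c′} → Matrix r c → Matrix r′ c′ → Matrix (r ℕ.* r′) (c ℕ.* c′)
_⊗_ {r} {c} {r′} {c′} M N i j =
  let i₁ , i₂ = remQuot {r} r′ i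
      j₁ , j₂ = remQuot {c} c′ j
  in M i₁ j₁ * N i₂ j₂

A : (k : ℕ) → Matrix k k
A k i j = coeff (Ψ k (X^ (toℕ j))) (toℕ i)

Unimodular : ∀ {n} → Matrix n n → Set
Unimodular P = ∃[ P′ ] (P · P′ ≈ 𝟙) × (P′ · P ≈ 𝟙)

record IsSmithNormalForm {r c} (M D : Matrix r c) : Set where
  field
    equivalent  : ∃[ P ] ∃[ Q ] Unimodular P × Unimodular Q × ((P · M) · Q ≈ D)
    diagonal    : ∀ i j → toℕ i ≢ toℕ j → D i j ≡ 0ℤ
    nonNegative : ∀ i j → toℕ i ≡ toℕ j → 0ℤ ≤ D i j
    divisible   : ∀ i j i′ j′ → toℕ i ≡ toℕ j →
                  toℕ i′ ≡ suc (toℕ i) → toℕ j′ ≡ suc (toℕ j) → D i j ∣ D i′ j′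

-- "S(M) = D", the normal form being a definite description: D is a Smith
-- normal form of M, and the only one.
record S[_]≈_ {r c} (M D : Matrix r c) : Set where
  field
    isSmithNormalForm : IsSmithNormalForm M D
    unique            : ∀ E → IsSmithNormalForm M E → E ≈ D

{-# OPTIONS --safe #-}
module Submission where

-- Let polynomials act on sequences h : ℕ → ℤ through the shift S, and let L d be the kernel of
-- Φ_d(S), a lattice of rank φ(d).  The rows of A k are bases of the L d, d ∣ k, restricted to
-- 0 ≤ j < k, and they are linearly independent.  For coprime d and d′, L (d d′) is spanned by
-- the products f g with f ∈ L d and g ∈ L d′: if a ≡ 1 mod d, a ≡ 0 mod d′ and a + b ≡ 1 mod d d′,
-- then h ∈ L (d d′) is the diagonal of h (a j + b j′), which lies in L d in j and in L d′ in j′.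
-- Hence A m ⊗ A n, with columns permuted by the Chinese remainder theorem, and A (m n) have the
-- same row lattice, so they are equivalent.
--
-- Everything about Φ_d rests on kernels.  If Sⁿ - 1 = f(S) g(S), then ker f(S) ∩ ker g(S) = 0,
-- because ((Sⁿ - 1) θ h) j = n · h j for (θ h) j = j · h j and n-periodic h.  This makes the L d with
-- d ∣ n independent, which in turn gives the exactness of the division defining Φ_n.
--
-- Uniqueness of the Smith normal form: if P D Q = E with D and E diagonal divisibility chains,
-- choose x with gcd 1, supported on the coordinates ≤ k, such that the first k coordinates of
-- Q x vanish; then D k k divides E x, hence E k k.

open import Defs
import Algebra.Properties.AbelianGroup
open import Data.Fin.Base using (Fin; zero; suc; toℕ; fromℕ<; combine; remQuot; _↑ˡ_; _↑ʳ_)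
import Data.Fin.Properties as Fin
open import Data.Integer.Base as ℤ using (ℤ; _+_; _*_; _-_; -_; 0ℤ; 1ℤ; -1ℤ)
import Data.Integer.DivMod as ℤ
import Data.Integer.Divisibility.Signed as ℤ
import Data.Integer.Properties as ℤ
open import Data.Integer.Tactic.RingSolver using (solve-∀)
open import Data.List.Base as List using (List; []; _∷_; _∷ʳ_; _++_; length; map; filter; foldr; take; replicate; upTo)
open import Data.List.Membership.Propositional using (_∈_)
open import Data.List.Membership.Propositional.Properties using (∈-filter⁺; ∈-filter⁻; ∈-map⁺; ∈-map⁻; ∈-upTo⁺; ∈-upTo⁻; ∈-concatMap⁺; ∈-concatMap⁻)
open import Data.List.Membership.Propositional.Properties.WithK using (unique∧set⇒bag)
import Data.List.Properties as List
open import Data.List.Relation.Binary.BagAndSetEquality using (∼bag⇒↭)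
open import Data.List.Relation.Binary.Permutation.Propositional.Properties using (↭-length)
open import Data.List.Relation.Unary.All as All using (All; []; _∷_)
import Data.List.Relation.Unary.All.Properties as All
open import Data.List.Relation.Unary.AllPairs as AllPairs using ([]; _∷_)
import Data.List.Relation.Unary.AllPairs.Properties as AllPairs
open import Data.List.Relation.Unary.Any as Any using (here; there)
open import Data.List.Relation.Unary.Unique.Propositional using (Unique)
import Data.List.Relation.Unary.Unique.Propositional.Properties as Unique
open import Data.Nat.Base as ℕ using (ℕ; zero; suc; pred; _∸_; NonZero; z≤n; s≤s)
open import Data.Nat.Coprimality as Coprimality using (Coprime; coprime?; coprime⇒gcd≡1; gcd≡1⇒coprime; coprime-Bézout; coprime-divisor)
open import Data.Nat.DivMod using (_%_; m≡m%n+[m/n]*n; m%n<n; m<n⇒m%n≡m; %-remove-+ʳ; m∣n⇒o%n%m≡o%m)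
open import Data.Nat.Divisibility as ℕ using (_∣_; _∣?_; divides)
open import Data.Nat.GCD using (gcd; gcd-GCD; gcd-greatest; gcd[m,n]∣m; gcd[m,n]∣n; c*gcd[m,n]≡gcd[cm,cn]; module Bézout)
open import Data.Nat.Induction using (<-rec)
open import Data.Nat.ListAction using () renaming (sum to Σ)
import Data.Nat.ListAction.Properties as Σ
import Data.Nat.Properties as ℕ
open import Data.Nat.Tactic.RingSolver using () renaming (solve-∀ to ℕ-solve-∀)
open import Data.Product.Base using (∃-syntax; ∃₂; _×_; _,_; proj₁; proj₂)
open import Data.Sum.Base using (_⊎_; inj₁; inj₂; [_,_]′)
open import Data.Vec.Base as Vec using (Vec; []; _∷_; toList; tabulate)
import Data.Vec.Properties as Vec
open import Function.Base using (_∘_; id)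
open import Function.Bundles using (mk⇔)
open import Relation.Binary.Definitions using (tri<; tri≈; tri>)
open import Relation.Binary.PropositionalEquality
open import Relation.Nullary using (¬_; yes; no; contradiction)

open import Algebra.Properties.Semiring.Sum ℤ.+-*-semiring using (sum; sum-cong-≗; ∑-distrib-+; ∑-comm; *-distribˡ-sum; *-distribʳ-sum)

-- Matrices

-- Sequences stand in for the quotient rings because of two difficulties. A list may carry trailing
-- zeros, so identities between lists of coefficients hold only up to padding; lists that differ by
-- padding act alike on sequences, and every identity becomes a pointwise one. Moreover the `i`-th
-- coordinate of `Xʲ` modulo `Φ d`, read as a function of `j`, is itself a sequence killed by `Φ d`,
-- namely the one whose first `φ d` terms form the `i`-th unit vector.
--
-- The length `φ d` of a block is prescribed by counting, while the degree of `Φ d` results from a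
-- recursive division. The two agree because both have sum `n` over the divisors of `n`.
--
-- The coefficients of `Φ d` are not accessible, so that a product or a subsequence lies in some
-- `L d` cannot be checked by applying `Φ d`. It is decided by the vanishing of sums along
-- arithmetic progressions.
--
-- As `S[ M ]≈ D` asserts that the normal form exists and is unique, both facts are proved for
-- integer matrices, and equivalence is all that remains to be shown of the two matrices.

sum-zero : ∀ n {f : Fin n → ℤ} → (∀ i → f i ≡ 0ℤ) → sum f ≡ 0ℤ
sum-zero zero    eq = refl
sum-zero (suc n) eq = cong₂ _+_ (eq zero) (sum-zero n (eq ∘ suc))

≈-sym : ∀ {r c} {M N : Matrix r c} → M ≈ N → N ≈ M
≈-sym eq i j = sym (eq i j)

≈-trans : ∀ {r c} {M N K : Matrix r c} → M ≈ N → N ≈ K → M ≈ K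
≈-trans eq eq′ i j = trans (eq i j) (eq′ i j)

·-cong : ∀ {r s c} {M M′ : Matrix r s} {N N′ : Matrix s c} → M ≈ M′ → N ≈ N′ → M · N ≈ M′ · N′
·-cong eq eq′ i j = sum-cong-≗ (λ l → cong₂ _*_ (eq i l) (eq′ l j))

·-congˡ : ∀ {r s c} (M : Matrix r s) {N N′ : Matrix s c} → N ≈ N′ → M · N ≈ M · N′
·-congˡ M = ·-cong {M = M} (λ _ _ → refl)

·-congʳ : ∀ {r s c} {M M′ : Matrix r s} (N : Matrix s c) → M ≈ M′ → M · N ≈ M′ · N
·-congʳ N eq = ·-cong {N = N} eq (λ _ _ → refl)

·-assoc : ∀ {r s t c} (M : Matrix r s) (N : Matrix s t) (K : Matrix t c) → (M · N) · K ≈ M · (N · K)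
·-assoc {s = s} {t} M N K i j = begin
  sum (λ l → sum (λ k → M i k * N k l) * K l j)
    ≡⟨ sum-cong-≗ {t} (λ l → *-distribʳ-sum (K l j) (λ k → M i k * N k l)) ⟩
  sum (λ l → sum (λ k → M i k * N k l * K l j))
    ≡⟨ ∑-comm {t} {s} (λ l k → M i k * N k l * K l j) ⟩
  sum (λ k → sum (λ l → M i k * N k l * K l j))
    ≡⟨ sum-cong-≗ {s} (λ k → trans (sum-cong-≗ {t} (λ l → ℤ.*-assoc (M i k) (N k l) (K l j))) (sym (*-distribˡ-sum (M i k) (λ l → N k l * K l j)))) ⟩
  sum (λ k → M i k * sum (λ l → N k l * K l j)) ∎
  where open ≡-Reasoning

sum-𝟙 : ∀ {n} (i : Fin n) (f : Fin n → ℤ) → sum (λ l → 𝟙 i l * f l) ≡ f i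
sum-𝟙 {suc n} zero    f = trans (cong₂ _+_ (ℤ.*-identityˡ (f zero)) (sum-zero n (λ _ → refl))) (ℤ.+-identityʳ _)
sum-𝟙 {suc n} (suc i) f = trans (ℤ.+-identityˡ _) (sum-𝟙 i (f ∘ suc))

𝟙-sym : ∀ {n} (i j : Fin n) → 𝟙 i j ≡ 𝟙 j i
𝟙-sym zero    zero    = refl
𝟙-sym zero    (suc j) = refl
𝟙-sym (suc i) zero    = refl
𝟙-sym (suc i) (suc j) = 𝟙-sym i j

·-identityˡ : ∀ {r c} (M : Matrix r c) → 𝟙 · M ≈ M
·-identityˡ M i j = sum-𝟙 i (λ l → M l j)

·-identityʳ : ∀ {r c} (M : Matrix r c) → M · 𝟙 ≈ M
·-identityʳ {c = c} M i j = trans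
  (sum-cong-≗ {c} (λ l → trans (ℤ.*-comm (M i l) (𝟙 l j)) (cong (_* M i l) (𝟙-sym l j)))) (sum-𝟙 j (M i))

_ᵀ : ∀ {r c} → Matrix r c → Matrix c r
(M ᵀ) i j = M j i

ᵀ-· : ∀ {r s c} (M : Matrix r s) (N : Matrix s c) → (M · N) ᵀ ≈ N ᵀ · M ᵀ
ᵀ-· {s = s} M N i j = sum-cong-≗ {s} (λ l → ℤ.*-comm (M j l) (N l i))

Unimodular-𝟙 : ∀ {n} → Unimodular (𝟙 {n})
Unimodular-𝟙 = 𝟙 , ·-identityˡ 𝟙 , ·-identityˡ 𝟙

Unimodular-inverse : ∀ {n} {P : Matrix n n} (u : Unimodular P) → Unimodular (proj₁ u)
Unimodular-inverse {P = P} (P′ , PP′ , P′P) = P , P′P , PP′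

Unimodular-· : ∀ {n} {P Q : Matrix n n} → Unimodular P → Unimodular Q → Unimodular (P · Q)
Unimodular-· {P = P} {Q} (P′ , PP′ , P′P) (Q′ , QQ′ , Q′Q) = Q′ · P′ , cancel P Q Q′ P′ QQ′ PP′ , cancel Q′ P′ P Q P′P Q′Q
  where
  cancel : ∀ A B C D → B · C ≈ 𝟙 → A · D ≈ 𝟙 → (A · B) · (C · D) ≈ 𝟙
  cancel A B C D BC AD = ≈-trans (·-assoc A B (C · D)) (≈-trans
    (·-congˡ A (≈-trans (≈-sym (·-assoc B C D)) (≈-trans (·-congʳ D BC) (·-identityˡ D)))) AD)

Unimodular-ᵀ : ∀ {n} {P : Matrix n n} → Unimodular P → Unimodular (P ᵀ)
Unimodular-ᵀ {P = P} (P′ , PP′ , P′P) = P′ ᵀ ,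
  (λ i j → trans (sym (ᵀ-· P′ P i j)) (trans (P′P j i) (𝟙-sym j i))) ,
  (λ i j → trans (sym (ᵀ-· P P′ i j)) (trans (PP′ j i) (𝟙-sym j i)))

-- Equivalence of matrices under unimodular row and column operations

infix 4 _∼_

-- A record and not a synonym, so that unification recovers `M` and `N` from `M ∼ N`; the unfolded
-- pointwise equation would not determine them.
record _∼_ {r c} (M N : Matrix r c) : Set where
  constructor ⟨_⟩
  field
    equivalence : ∃[ P ] ∃[ Q ] Unimodular P × Unimodular Q × ((P · M) · Q ≈ N)

open _∼_

∼-left : ∀ {r c} {P : Matrix r r} {M N : Matrix r c} → Unimodular P → P · M ≈ N → M ∼ N
∼-left {P = P} {M} uP eq = ⟨ P , 𝟙 , uP , Unimodular-𝟙 , ≈-trans (·-identityʳ (P · M)) eq ⟩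

∼-right : ∀ {r c} {Q : Matrix c c} {M N : Matrix r c} → Unimodular Q → M · Q ≈ N → M ∼ N
∼-right {Q = Q} {M} uQ eq = ⟨ 𝟙 , Q , Unimodular-𝟙 , uQ , ≈-trans (·-congʳ Q (·-identityˡ M)) eq ⟩

∼-reflexive : ∀ {r c} {M N : Matrix r c} → M ≈ N → M ∼ N
∼-reflexive {M = M} eq = ∼-left Unimodular-𝟙 (≈-trans (·-identityˡ M) eq)

∼-trans : ∀ {r c} {M N K : Matrix r c} → M ∼ N → N ∼ K → M ∼ K
∼-trans {M = M} {N} {K} ⟨ P , Q , uP , uQ , eq ⟩ ⟨ P₂ , Q₂ , uP₂ , uQ₂ , eq₂ ⟩ =
  ⟨ P₂ · P , Q · Q₂ , Unimodular-· uP₂ uP , Unimodular-· uQ uQ₂ , product ⟩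
  where
  product : ((P₂ · P) · M) · (Q · Q₂) ≈ K
  product = ≈-trans (≈-sym (·-assoc ((P₂ · P) · M) Q Q₂)) (≈-trans (·-congʳ Q₂ (≈-trans (·-congʳ Q (·-assoc P₂ P M))
    (≈-trans (·-assoc P₂ (P · M) Q) (·-congˡ P₂ eq)))) eq₂)

∼-sym : ∀ {r c} {M N : Matrix r c} → M ∼ N → N ∼ M
∼-sym {M = M} {N} ⟨ P , Q , uP@(P′ , PP′ , P′P) , uQ@(Q′ , QQ′ , Q′Q) , eq ⟩ =
  ⟨ P′ , Q′ , Unimodular-inverse uP , Unimodular-inverse uQ ,
  ≈-trans (·-congʳ Q′ (·-congˡ P′ (≈-sym eq))) (≈-trans (·-congʳ Q′ (≈-trans (≈-sym (·-assoc P′ (P · M) Q))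
    (·-congʳ Q (≈-trans (≈-sym (·-assoc P′ P M)) (≈-trans (·-congʳ M P′P) (·-identityˡ M))))))
    (≈-trans (·-assoc M Q Q′) (≈-trans (·-congˡ M QQ′) (·-identityʳ M)))) ⟩

∼-ᵀ : ∀ {r c} {M N : Matrix r c} → M ∼ N → M ᵀ ∼ N ᵀ
∼-ᵀ {M = M} ⟨ P , Q , uP , uQ , eq ⟩ = ⟨ Q ᵀ , P ᵀ , Unimodular-ᵀ uQ , Unimodular-ᵀ uP , (λ i j →
  trans (·-assoc (Q ᵀ) (M ᵀ) (P ᵀ) i j) (trans (·-congˡ (Q ᵀ) (≈-sym (ᵀ-· P M)) i j) (trans (sym (ᵀ-· (P · M) Q i j)) (eq j i)))) ⟩

∣-sum : ∀ {d n} {f : Fin n → ℤ} → (∀ i → d ℤ.∣ f i) → d ℤ.∣ sum f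
∣-sum {n = zero}  d∣f = ℤ.divides 0ℤ refl
∣-sum {n = suc n} d∣f = ℤ.∣m∣n⇒∣m+n (d∣f zero) (∣-sum (d∣f ∘ suc))

-- Entries of `N` are integer combinations of entries of `M`. In the elimination this keeps the
-- pivot a divisor of everything that comes after it.
∼-∣ : ∀ {r c d} {M N : Matrix r c} → M ∼ N → (∀ i j → d ℤ.∣ M i j) → ∀ i j → d ℤ.∣ N i j
∼-∣ {d = d} ⟨ P , Q , _ , _ , eq ⟩ d∣M i j = subst (d ℤ.∣_) (eq i j)
  (∣-sum (λ l → ℤ.∣m⇒∣m*n (Q l j) (∣-sum (λ k → ℤ.∣n⇒∣m*n (P i k) (d∣M k l)))))

-- Existence of the Smith normal form

-- Applied to `𝟙`, the operation yields its own elementary matrix, and negated multipliers yield the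
-- inverse. The same holds for `addToHead`.
addMultiplesOfHead : ∀ {n c} → (Fin n → ℤ) → Matrix (suc n) c → Matrix (suc n) c
addMultiplesOfHead t M zero    j = M zero j
addMultiplesOfHead t M (suc i) j = M (suc i) j + t i * M zero j

addToHead : ∀ {n c} → Fin n → ℤ → Matrix (suc n) c → Matrix (suc n) c
addToHead l t M zero    j = M zero j + t * M (suc l) j
addToHead l t M (suc i) j = M (suc i) j

lower-· : ∀ {n c} t (M : Matrix (suc n) c) → addMultiplesOfHead t 𝟙 · M ≈ addMultiplesOfHead t M
lower-· t M zero    j = ·-identityˡ M zero j
lower-· {n} t M (suc i) j = begin
  (0ℤ + t i * 1ℤ) * M zero j + sum (λ l → (𝟙 i l + t i * 0ℤ) * M (suc l) j)
    ≡⟨ cong₂ _+_ (lemma (t i) (M zero j)) (sum-cong-≗ {n} (λ l → cong (_* M (suc l) j) (lemma′ (t i) (𝟙 i l)))) ⟩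
  t i * M zero j + sum (λ l → 𝟙 i l * M (suc l) j)
    ≡⟨ cong (λ x → t i * M zero j + x) (sum-𝟙 i (λ l → M (suc l) j)) ⟩
  t i * M zero j + M (suc i) j
    ≡⟨ ℤ.+-comm (t i * M zero j) _ ⟩
  M (suc i) j + t i * M zero j ∎
  where
  open ≡-Reasoning
  lemma : ∀ t x → (0ℤ + t * 1ℤ) * x ≡ t * x
  lemma = solve-∀
  lemma′ : ∀ t x → x + t * 0ℤ ≡ x
  lemma′ = solve-∀

upper-· : ∀ {n c} l t (M : Matrix (suc n) c) → addToHead l t 𝟙 · M ≈ addToHead l t M
upper-· {n} l t M zero j = begin
  (1ℤ + t * 0ℤ) * M zero j + sum (λ k → (0ℤ + t * 𝟙 l k) * M (suc k) j)
    ≡⟨ cong₂ _+_ (lemma t (M zero j)) (trans (sum-cong-≗ {n} (λ k → lemma′ t (𝟙 l k) (M (suc k) j))) (sym (*-distribˡ-sum t (λ k → 𝟙 l k * M (suc k) j)))) ⟩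
  M zero j + t * sum (λ k → 𝟙 l k * M (suc k) j)
    ≡⟨ cong (λ x → M zero j + t * x) (sum-𝟙 l (λ k → M (suc k) j)) ⟩
  M zero j + t * M (suc l) j ∎
  where
  open ≡-Reasoning
  lemma : ∀ t x → (1ℤ + t * 0ℤ) * x ≡ x
  lemma = solve-∀
  lemma′ : ∀ t x y → (0ℤ + t * x) * y ≡ t * (x * y)
  lemma′ = solve-∀
upper-· l t M (suc i) j = ·-identityˡ M (suc i) j

lower-inverse : ∀ {n} (t : Fin n → ℤ) → addMultiplesOfHead t 𝟙 · addMultiplesOfHead (-_ ∘ t) 𝟙 ≈ 𝟙
lower-inverse t zero    j = lower-· t (addMultiplesOfHead (-_ ∘ t) 𝟙) zero j
lower-inverse t (suc i) j = trans (lower-· t (addMultiplesOfHead (-_ ∘ t) 𝟙) (suc i) j) (lemma (𝟙 (suc i) j) (t i) (𝟙 zero j))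
  where
  lemma : ∀ x t y → x + - t * y + t * y ≡ x
  lemma = solve-∀

upper-inverse : ∀ {n} (l : Fin n) t → addToHead l t 𝟙 · addToHead l (- t) 𝟙 ≈ 𝟙
upper-inverse l t zero    j = trans (upper-· l t (addToHead l (- t) 𝟙) zero j) (lemma (𝟙 zero j) t (𝟙 (suc l) j))
  where
  lemma : ∀ x t y → x + - t * y + t * y ≡ x
  lemma = solve-∀
upper-inverse l t (suc i) j = upper-· l t (addToHead l (- t) 𝟙) (suc i) j

addMultiplesOfHead-∼ : ∀ {n c} t (M : Matrix (suc n) c) → M ∼ addMultiplesOfHead t M
addMultiplesOfHead-∼ t M = ∼-left {P = addMultiplesOfHead t 𝟙} {M} (addMultiplesOfHead (-_ ∘ t) 𝟙 , lower-inverse t ,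
  ≈-trans (·-congˡ (addMultiplesOfHead (-_ ∘ t) 𝟙) double-negation) (lower-inverse (-_ ∘ t))) (lower-· t M)
  where
  double-negation : addMultiplesOfHead t 𝟙 ≈ addMultiplesOfHead (-_ ∘ -_ ∘ t) 𝟙
  double-negation zero    j = refl
  double-negation (suc i) j = cong (λ t → 𝟙 (suc i) j + t * 𝟙 zero j) (sym (ℤ.neg-involutive (t i)))

addToHead-∼ : ∀ {n c} l t (M : Matrix (suc n) c) → M ∼ addToHead l t M
addToHead-∼ l t M = ∼-left {P = addToHead l t 𝟙} {M} (addToHead l (- t) 𝟙 , upper-inverse l t ,
  ≈-trans (·-congˡ (addToHead l (- t) 𝟙) double-negation) (upper-inverse l (- t))) (upper-· l t M)
  where
  double-negation : addToHead l t 𝟙 ≈ addToHead l (- - t) 𝟙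
  double-negation zero    j = cong (λ t → 𝟙 zero j + t * 𝟙 (suc l) j) (sym (ℤ.neg-involutive t))
  double-negation (suc i) j = refl

neg-∼ : ∀ {r c} (M : Matrix r c) → M ∼ (λ i j → - M i j)
neg-∼ {r} M = ∼-left {P = λ i j → - 𝟙 i j} {M} ((λ i j → - 𝟙 i j) , square , square) (neg-· M)
  where
  neg-· : ∀ {c} (M : Matrix r c) → (λ i j → - 𝟙 i j) · M ≈ (λ i j → - M i j)
  neg-· M i j = begin
    sum (λ l → - 𝟙 i l * M l j)        ≡⟨ sum-cong-≗ {r} (λ l → lemma (𝟙 i l) (M l j)) ⟩
    sum (λ l → -1ℤ * (𝟙 i l * M l j))  ≡⟨ *-distribˡ-sum -1ℤ (λ l → 𝟙 i l * M l j) ⟨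
    -1ℤ * sum (λ l → 𝟙 i l * M l j)    ≡⟨ cong (-1ℤ *_) (sum-𝟙 i (λ l → M l j)) ⟩
    -1ℤ * M i j                        ≡⟨ ℤ.-1*i≡-i (M i j) ⟩
    - M i j                            ∎
    where
    open ≡-Reasoning
    lemma : ∀ x y → - x * y ≡ -1ℤ * (x * y)
    lemma = solve-∀
  square : (λ i j → - 𝟙 i j) · (λ i j → - 𝟙 i j) ≈ 𝟙
  square i j = trans (neg-· (λ i j → - 𝟙 i j) i j) (ℤ.neg-involutive (𝟙 i j))

border : ∀ {r c} → ℤ → Matrix r c → Matrix (suc r) (suc c)
border d M zero    zero    = d
border d M zero    (suc j) = 0ℤ
border d M (suc i) zero    = 0ℤ
border d M (suc i) (suc j) = M i j

border-· : ∀ {r s c} a b (M : Matrix r s) (N : Matrix s c) → border a M · border b N ≈ border (a * b) (M · N)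
border-· {s = s} a b M N zero    zero    = trans (cong (λ x → a * b + x) (sum-zero s (λ _ → refl))) (ℤ.+-identityʳ _)
border-· {s = s} a b M N zero    (suc j) = cong₂ _+_ (ℤ.*-zeroʳ a) (sum-zero s (λ _ → refl))
border-· {s = s} a b M N (suc i) zero    = trans (ℤ.+-identityˡ _) (sum-zero s (λ l → ℤ.*-zeroʳ (M i l)))
border-· {s = s} a b M N (suc i) (suc j) = ℤ.+-identityˡ _

border-cong : ∀ {r c a b} {M N : Matrix r c} → a ≡ b → M ≈ N → border a M ≈ border b N
border-cong a≡b eq zero    zero    = a≡b
border-cong a≡b eq zero    (suc j) = refl
border-cong a≡b eq (suc i) zero    = refl
border-cong a≡b eq (suc i) (suc j) = eq i j

border-𝟙 : ∀ {n} → border 1ℤ (𝟙 {n}) ≈ 𝟙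
border-𝟙 zero    zero    = refl
border-𝟙 zero    (suc j) = refl
border-𝟙 (suc i) zero    = refl
border-𝟙 (suc i) (suc j) = refl

Unimodular-border : ∀ {n} {P : Matrix n n} → Unimodular P → Unimodular (border 1ℤ P)
Unimodular-border {P = P} (P′ , PP′ , P′P) = border 1ℤ P′ ,
  ≈-trans (border-· 1ℤ 1ℤ P P′) (≈-trans (border-cong refl PP′) border-𝟙) ,
  ≈-trans (border-· 1ℤ 1ℤ P′ P) (≈-trans (border-cong refl P′P) border-𝟙)

border-∼ : ∀ {r c} d {M N : Matrix r c} → M ∼ N → border d M ∼ border d N
border-∼ d {M} ⟨ P , Q , uP , uQ , eq ⟩ = ⟨ border 1ℤ P , border 1ℤ Q , Unimodular-border uP , Unimodular-border uQ ,
  ≈-trans (·-congʳ (border 1ℤ Q) (border-· 1ℤ d P M))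
    (≈-trans (border-· (1ℤ * d) 1ℤ (P · M) Q) (border-cong (trans (ℤ.*-identityʳ (1ℤ * d)) (ℤ.*-identityˡ d)) eq)) ⟩

-- A nonzero remainder s of an entry below the pivot + suc a gives, after subtracting
-- ⌊a / s⌋ times its row from the first one, the pivot + suc (a % s).
improvePivot : ∀ {r c a} (M : Matrix (suc r) (suc c)) → M zero zero ≡ ℤ.+ suc a →
  ∀ i → ¬ (ℤ.+ suc a ℤ.∣ M (suc i) zero) → ∃[ N ] ∃[ b ] M ∼ N × b ℕ.< a × N zero zero ≡ ℤ.+ suc b
improvePivot {r} {c} {a} M M₀₀ i a∤ with M (suc i) zero ℤ.%ℕ suc a in rem | ℤ.n%ℕd<d (M (suc i) zero) (suc a)
... | zero | _ = contradiction (ℤ.divides (M (suc i) zero ℤ./ℕ suc a) (trans (ℤ.a≡a%ℕn+[a/ℕn]*n (M (suc i) zero) (suc a))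
    (trans (cong (λ s → ℤ.+ s + q * ℤ.+ suc a) rem) (ℤ.+-identityˡ _)))) a∤
  where
  q = M (suc i) zero ℤ./ℕ suc a
... | s@(suc s′) | s≤s s≤a = N₂ , a ℕ.% s ,
    ∼-trans (addMultiplesOfHead-∼ t M) (addToHead-∼ i (- (ℤ.+ (a ℕ./ s))) N₁) ,
    ℕ.<-≤-trans (m%n<n a s) s≤a , pivot
  where
  open ≡-Reasoning
  q = M (suc i) zero ℤ./ℕ suc a
  t : Fin r → ℤ
  t l = - (M (suc l) zero ℤ./ℕ suc a)
  N₁ N₂ : Matrix (suc r) (suc c)
  N₁ = addMultiplesOfHead t M
  N₂ = addToHead i (- (ℤ.+ (a ℕ./ s))) N₁
  cancel : ∀ x q y → x + q * y + - q * y ≡ x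
  cancel = solve-∀
  entry : N₁ (suc i) zero ≡ ℤ.+ s
  entry = begin
    M (suc i) zero + - q * M zero zero
      ≡⟨ cong₂ (λ x y → x + - q * y) (trans (ℤ.a≡a%ℕn+[a/ℕn]*n (M (suc i) zero) (suc a)) (cong (λ s → ℤ.+ s + q * ℤ.+ suc a) rem)) M₀₀ ⟩
    ℤ.+ s + q * ℤ.+ suc a + - q * ℤ.+ suc a
      ≡⟨ cancel (ℤ.+ s) q (ℤ.+ suc a) ⟩
    ℤ.+ s ∎
  pivot : N₂ zero zero ≡ ℤ.+ suc (a ℕ.% s)
  pivot = begin
    M zero zero + - (ℤ.+ (a ℕ./ s)) * N₁ (suc i) zero
      ≡⟨ cong₂ (λ x y → x + - (ℤ.+ (a ℕ./ s)) * y) (trans M₀₀ (cong (λ a → ℤ.+ suc a) (m≡m%n+[m/n]*n a s))) entry ⟩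
    ℤ.+ (suc (a ℕ.% s) ℕ.+ (a ℕ./ s) ℕ.* s) + - (ℤ.+ (a ℕ./ s)) * ℤ.+ s
      ≡⟨ cong (_+ - (ℤ.+ (a ℕ./ s)) * ℤ.+ s) (trans (ℤ.pos-+ (suc (a ℕ.% s)) _) (cong (ℤ.+ suc (a ℕ.% s) +_) (ℤ.pos-* (a ℕ./ s) s))) ⟩
    ℤ.+ suc (a ℕ.% s) + ℤ.+ (a ℕ./ s) * ℤ.+ s + - (ℤ.+ (a ℕ./ s)) * ℤ.+ s
      ≡⟨ cancel (ℤ.+ suc (a ℕ.% s)) (ℤ.+ (a ℕ./ s)) (ℤ.+ s) ⟩
    ℤ.+ suc (a ℕ.% s) ∎

-- One complete round of elimination: the pivot split off divides the whole remaining block. Writing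
-- it as `suc d` keeps it positive.
Reducible : ∀ {r c} → Matrix (suc r) (suc c) → Set
Reducible M = ∃[ N ] ∃[ d ] M ∼ border (ℤ.+ suc d) N × (∀ i j → ℤ.+ suc d ℤ.∣ N i j)

Reducible-∼ : ∀ {r c} {M N : Matrix (suc r) (suc c)} → M ∼ N → Reducible N → Reducible M
Reducible-∼ M∼N (K , d , N∼K , d∣K) = K , d , ∼-trans M∼N N∼K , d∣K

Reducible-ᵀ : ∀ {r c} {M : Matrix (suc r) (suc c)} → Reducible M → Reducible (M ᵀ)
Reducible-ᵀ {M = M} (K , d , M∼K , d∣K) = K ᵀ , d , ∼-trans (∼-ᵀ M∼K) (∼-reflexive border-ᵀ) , λ i j → d∣K j i
  where
  border-ᵀ : border (ℤ.+ suc d) K ᵀ ≈ border (ℤ.+ suc d) (K ᵀ)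
  border-ᵀ zero    zero    = refl
  border-ᵀ zero    (suc j) = refl
  border-ᵀ (suc i) zero    = refl
  border-ᵀ (suc i) (suc j) = refl

clearCross : ∀ {r c a} (M : Matrix (suc r) (suc c)) → M zero zero ≡ a →
  (∀ i → a ℤ.∣ M (suc i) zero) → (∀ j → a ℤ.∣ M zero (suc j)) → ∃[ N ] M ∼ border a N
clearCross {r} {c} {a} M M₀₀ column row = N , ∼-trans (addMultiplesOfHead-∼ t M)
    (∼-trans (∼-ᵀ (addMultiplesOfHead-∼ u (N₁ ᵀ))) (∼-reflexive cleared))
  where
  open ℤ._∣_
  t : Fin r → ℤ
  t i = - quotient (column i)
  u : Fin c → ℤ
  u j = - quotient (row j)
  N₁ = addMultiplesOfHead t M
  N : Matrix r c
  N i j = N₁ (suc i) (suc j)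
  eliminate : ∀ {x y} (y∣x : a ℤ.∣ x) → y ≡ a → x + - quotient y∣x * y ≡ 0ℤ
  eliminate (ℤ.divides q refl) refl = trans (cong (q * a +_) (sym (ℤ.neg-distribˡ-* q a))) (ℤ.+-inverseʳ (q * a))
  column-cleared : ∀ i → N₁ (suc i) zero ≡ 0ℤ
  column-cleared i = eliminate (column i) M₀₀
  cleared : addMultiplesOfHead u (N₁ ᵀ) ᵀ ≈ border a N
  cleared zero    zero    = M₀₀
  cleared (suc i) zero    = column-cleared i
  cleared zero    (suc j) = eliminate (row j) M₀₀
  -- The first column is already zero below the pivot, so clearing the first row leaves the inner
  -- block unchanged.
  cleared (suc i) (suc j) = trans (cong (λ x → N i j + u j * x) (column-cleared i))
    (trans (cong (N i j +_) (ℤ.*-zeroʳ (u j))) (ℤ.+-identityʳ _))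

-- Induction on the pivot: an entry that it does not divide, be it in the first column, in the first
-- row or in the inner block after clearing both, leads to an equivalent matrix with a smaller
-- positive pivot.
reduce : ∀ a r c (M : Matrix (suc r) (suc c)) → M zero zero ≡ ℤ.+ suc a → Reducible M
reduce = <-rec (λ a → ∀ r c (M : Matrix (suc r) (suc c)) → M zero zero ≡ ℤ.+ suc a → Reducible M) step
  where
  step : ∀ a → (∀ {b} → b ℕ.< a → ∀ r c (M : Matrix (suc r) (suc c)) → M zero zero ≡ ℤ.+ suc b → Reducible M) →
    ∀ r c (M : Matrix (suc r) (suc c)) → M zero zero ≡ ℤ.+ suc a → Reducible M
  step a rec r c M M₀₀ = cases
    where
    column : ∀ {r c} (M : Matrix (suc r) (suc c)) → M zero zero ≡ ℤ.+ suc a →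
      ∀ i → ¬ (ℤ.+ suc a ℤ.∣ M (suc i) zero) → Reducible M
    column M M₀₀ i a∤ = let N , b , M∼N , b<a , N₀₀ = improvePivot M M₀₀ i a∤ in Reducible-∼ M∼N (rec b<a _ _ N N₀₀)
    core : ∀ N → M ∼ border (ℤ.+ suc a) N → Reducible M
    core N M∼N with Fin.all? (λ i → Fin.all? (λ j → ℤ.+ suc a ℤ.∣? N i j))
    ... | yes a∣N = N , a , M∼N , a∣N
    ... | no ¬a∣N with Fin.¬∀⟶∃¬ r (λ i → ∀ j → ℤ.+ suc a ℤ.∣ N i j) (λ i → Fin.all? (λ j → ℤ.+ suc a ℤ.∣? N i j)) ¬a∣N
    ... | i , ¬a∣Nᵢ with Fin.¬∀⟶∃¬ c (λ j → ℤ.+ suc a ℤ.∣ N i j) (λ j → ℤ.+ suc a ℤ.∣? N i j) ¬a∣Nᵢ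
    -- Adding its row to the first row brings the offending entry next to the pivot, which does not
    -- change because that row begins with 0. `column` then applies to the transpose.
    ... | j , a∤Nᵢⱼ = Reducible-∼ (∼-trans M∼N (addToHead-∼ i 1ℤ (border (ℤ.+ suc a) N)))
      (Reducible-ᵀ (column (addToHead i 1ℤ (border (ℤ.+ suc a) N) ᵀ) (ℤ.+-identityʳ _) j
        (λ a∣ → a∤Nᵢⱼ (subst (ℤ.+ suc a ℤ.∣_) (trans (ℤ.+-identityˡ _) (ℤ.*-identityˡ (N i j))) a∣))))
    cases : Reducible M
    cases with Fin.all? (λ i → ℤ.+ suc a ℤ.∣? M (suc i) zero) | Fin.all? (λ j → ℤ.+ suc a ℤ.∣? M zero (suc j))
    ... | no ¬col | _ = let i , a∤ = Fin.¬∀⟶∃¬ r _ (λ i → ℤ.+ suc a ℤ.∣? M (suc i) zero) ¬col in column M M₀₀ i a∤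
    ... | yes _ | no ¬row = let j , a∤ = Fin.¬∀⟶∃¬ c _ (λ j → ℤ.+ suc a ℤ.∣? M zero (suc j)) ¬row in
      Reducible-ᵀ (column (M ᵀ) M₀₀ j a∤)
    ... | yes col | yes row = let N , M∼N = clearCross M M₀₀ col row in core N M∼N

nonzeroInHead : ∀ {r c} (M : Matrix (suc r) c) {i j} → M i j ≢ 0ℤ → ∃[ N ] M ∼ N × N zero j ≢ 0ℤ
nonzeroInHead M {zero}      nz = M , ∼-reflexive (λ _ _ → refl) , nz
nonzeroInHead M {suc i} {j} nz with M zero j ℤ.≟ 0ℤ
... | no  nz₀ = M , ∼-reflexive (λ _ _ → refl) , nz₀
... | yes z₀  = addToHead i 1ℤ M , addToHead-∼ i 1ℤ M ,
  λ eq → nz (trans (sym (ℤ.*-identityˡ _)) (trans (sym (ℤ.+-identityˡ _)) (trans (cong (_+ 1ℤ * M (suc i) j) (sym z₀)) eq)))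

-- `nonzeroInHead`, used on the matrix and then on the transpose, brings a nonzero entry to the
-- corner; a change of sign makes it positive.
nonzero-reducible : ∀ {r c} (M : Matrix (suc r) (suc c)) {i j} → M i j ≢ 0ℤ → Reducible M
nonzero-reducible {r} {c} M nz with nonzeroInHead M nz
... | N , M∼N , nzN with nonzeroInHead (N ᵀ) {j = zero} nzN
... | K , Nᵀ∼K , nzK with K zero zero in K₀₀
... | ℤ.+ zero   = contradiction refl nzK
... | ℤ.+ suc a  = Reducible-∼ (∼-trans M∼N (∼-ᵀ Nᵀ∼K)) (Reducible-ᵀ (reduce a c r K K₀₀))
... | ℤ.-[1+ a ] = Reducible-∼ (∼-trans M∼N (∼-ᵀ (∼-trans Nᵀ∼K (neg-∼ K)))) (Reducible-ᵀ (reduce a c r (λ i j → - K i j) (cong -_ K₀₀)))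

open IsSmithNormalForm

smith-border : ∀ {r c d} {M : Matrix (suc r) (suc c)} {N D : Matrix r c} →
  M ∼ border (ℤ.+ suc d) N → (∀ i j → ℤ.+ suc d ℤ.∣ N i j) → IsSmithNormalForm N D →
  IsSmithNormalForm M (border (ℤ.+ suc d) D)
smith-border {d = d} {D = D} M∼N d∣N snf = record
  { equivalent  = equivalence (∼-trans M∼N (border-∼ (ℤ.+ suc d) ⟨ equivalent snf ⟩))
  ; diagonal    = λ { zero zero ne → contradiction refl ne ; zero (suc j) _ → refl ; (suc i) zero _ → refl
                    ; (suc i) (suc j) ne → diagonal snf i j (ne ∘ cong suc) }
  ; nonNegative = λ { zero zero _ → ℤ.+≤+ z≤n ; (suc i) (suc j) eq → nonNegative snf i j (ℕ.suc-injective eq) }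
  -- The one divisibility that the smaller form does not supply is that of its first entry by the
  -- pivot; it is inherited from `N` through the equivalence.
  ; divisible   = λ { zero    zero    (suc i′) (suc j′) _  _   _   → ℤ.∣⇒∣ᵤ (∼-∣ ⟨ equivalent snf ⟩ d∣N i′ j′)
                    ; (suc i) (suc j) (suc i′) (suc j′) eq eqᵢ eqⱼ →
                        divisible snf i j i′ j′ (ℕ.suc-injective eq) (ℕ.suc-injective eqᵢ) (ℕ.suc-injective eqⱼ) }
  }

smith : ∀ r c (M : Matrix r c) → ∃[ D ] IsSmithNormalForm M D
smith zero c M = M , record
  { equivalent = equivalence {M = M} {M} (∼-reflexive (λ _ _ → refl)) ; diagonal = λ () ; nonNegative = λ () ; divisible = λ () }
smith (suc r) zero M = M , record
  { equivalent = equivalence {M = M} {M} (∼-reflexive (λ _ _ → refl)) ; diagonal = λ _ () ; nonNegative = λ _ () ; divisible = λ _ () }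
smith (suc r) (suc c) M with Fin.all? (λ i → Fin.all? (λ j → M i j ℤ.≟ 0ℤ))
... | yes zeros = M , record
  { equivalent  = equivalence {M = M} {M} (∼-reflexive (λ _ _ → refl))
  ; diagonal    = λ i j _ → zeros i j
  ; nonNegative = λ i j _ → ℤ.≤-reflexive (sym (zeros i j))
  ; divisible   = λ i j i′ j′ _ _ _ → ℤ.∣⇒∣ᵤ (subst (M i j ℤ.∣_) (sym (zeros i′ j′)) (ℤ.divides 0ℤ refl))
  }
... | no ¬zeros with Fin.¬∀⟶∃¬ (suc r) (λ i → ∀ j → M i j ≡ 0ℤ) (λ i → Fin.all? (λ j → M i j ℤ.≟ 0ℤ)) ¬zeros
... | i , ¬zerosᵢ with Fin.¬∀⟶∃¬ (suc c) (λ j → M i j ≡ 0ℤ) (λ j → M i j ℤ.≟ 0ℤ) ¬zerosᵢ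
... | j , nz = let N , d , M∼N , d∣N = nonzero-reducible M nz
                   D , snf = smith r c N
               in border (ℤ.+ suc d) D , smith-border M∼N d∣N snf

-- Uniqueness of the Smith normal form

infixr 7 _⊙_

_⊙_ : ∀ {r c} → Matrix r c → (Fin c → ℤ) → Fin r → ℤ
(M ⊙ x) i = sum (λ l → M i l * x l)

⊙-assoc : ∀ {r s c} (M : Matrix r s) (N : Matrix s c) x i → ((M · N) ⊙ x) i ≡ (M ⊙ (N ⊙ x)) i
⊙-assoc M N x i = ·-assoc {c = 1} M N (λ l _ → x l) i zero

-- `u` holds Bézout coefficients of `x`. This is gcd 1 in the form in which it is used: to recover a
-- number from its multiples by the entries of `x`.
PrimitiveKernel : ∀ {r c} → Matrix r c → Set
PrimitiveKernel {c = c} K = ∃₂ λ (x u : Fin c → ℤ) → sum (λ l → u l * x l) ≡ 1ℤ × (∀ i → (K ⊙ x) i ≡ 0ℤ)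

-- The Smith form `P K Q = D` gives `K Q = P′ D`. Row `k` of this is zero while row `k` of the
-- invertible `P′` is not, so some `D j j` vanishes. Column `j` of `Q` is then a kernel vector, with
-- row `j` of `Q′` as Bézout coefficients.
zeroRow⇒kernel : ∀ {n} (K : Matrix n n) k → (∀ j → K k j ≡ 0ℤ) → PrimitiveKernel K
zeroRow⇒kernel {n} K k zeros with smith n n K
... | D , snf with equivalent snf
... | P , Q , (P′ , PP′ , P′P) , (Q′ , QQ′ , Q′Q) , eq = conclude
  where
  open ≡-Reasoning
  𝟙-diagonal : ∀ {n} (i : Fin n) → 𝟙 i i ≡ 1ℤ
  𝟙-diagonal zero    = refl
  𝟙-diagonal (suc i) = 𝟙-diagonal i
  KQ≈P′D : K · Q ≈ P′ · D
  KQ≈P′D = ≈-trans (·-congʳ Q (≈-trans (≈-sym (·-identityˡ K)) (≈-trans (·-congʳ K (≈-sym P′P)) (·-assoc P′ P K))))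
    (≈-trans (·-assoc P′ (P · K) Q) (·-congˡ P′ eq))
  column : ∀ (M : Matrix n n) i j → (M · D) i j ≡ M i j * D j j
  column M i j = begin
    sum (λ l → M i l * D l j)                ≡⟨ sum-cong-≗ {n} (λ l → pick l) ⟩
    sum (λ l → 𝟙 j l * (M i l * D l j))      ≡⟨ sum-𝟙 j (λ l → M i l * D l j) ⟩
    M i j * D j j                            ∎
    where
    pick : ∀ l → M i l * D l j ≡ 𝟙 j l * (M i l * D l j)
    pick l with j Fin.≟ l
    ... | yes _  = sym (ℤ.*-identityˡ (M i l * D l j))
    ... | no j≢l = trans (cong (M i l *_) (diagonal snf l j (λ l≡j → j≢l (sym (Fin.toℕ-injective l≡j))))) (ℤ.*-zeroʳ (M i l))
  P′D≡0 : ∀ j → P′ k j * D j j ≡ 0ℤ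
  P′D≡0 j = trans (sym (column P′ k j)) (trans (sym (KQ≈P′D k j)) (sum-zero n (λ l → cong (_* Q l j) (zeros l))))
  kernel : ∀ j → D j j ≡ 0ℤ → PrimitiveKernel K
  kernel j Dⱼⱼ = (λ l → Q l j) , Q′ j , trans (Q′Q j j) (𝟙-diagonal j) , λ i →
    trans (KQ≈P′D i j) (trans (column P′ i j) (trans (cong (P′ i j *_) Dⱼⱼ) (ℤ.*-zeroʳ (P′ i j))))
  conclude : PrimitiveKernel K
  conclude with Fin.all? (λ j → P′ k j ℤ.≟ 0ℤ)
  ... | yes zero-row = contradiction (trans (sym (trans (P′P k k) (𝟙-diagonal k))) (sum-zero n (λ l → cong (_* P l k) (zero-row l)))) λ ()
  ... | no ¬zero-row = let j , nz = Fin.¬∀⟶∃¬ n (λ j → P′ k j ≡ 0ℤ) (λ j → P′ k j ℤ.≟ 0ℤ) ¬zero-row in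
    kernel j ([ (λ z → contradiction z nz) , id ]′ (ℤ.i*j≡0⇒i≡0∨j≡0 (P′ k j) (P′D≡0 j)))

smith-chain : ∀ {n} {M D : Matrix n n} → IsSmithNormalForm M D → ∀ {i j} → toℕ i ℕ.≤ toℕ j → D i i ℤ.∣ D j j
smith-chain {n} {D = D} snf {i} {j} i≤j = let m , eq = ℕ.m≤n⇒∃[o]m+o≡n i≤j in chain m (trans (sym eq) (ℕ.+-comm (toℕ i) m))
  where
  chain : ∀ m {j} → toℕ j ≡ m ℕ.+ toℕ i → D i i ℤ.∣ D j j
  chain zero    eq = subst (λ l → D i i ℤ.∣ D l l) (sym (Fin.toℕ-injective eq)) ℤ.∣-refl
  chain (suc m) {j} eq = ℤ.∣-trans (chain m {l} (Fin.toℕ-fromℕ< l<n)) (ℤ.∣ᵤ⇒∣ (divisible snf l l j j refl toℕ-j toℕ-j))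
    where
    l<n : m ℕ.+ toℕ i ℕ.< n
    l<n = ℕ.<-trans (ℕ.≤-reflexive (sym eq)) (Fin.toℕ<n j)
    l = fromℕ< l<n
    toℕ-j : toℕ j ≡ suc (toℕ l)
    toℕ-j = trans eq (cong suc (sym (Fin.toℕ-fromℕ< l<n)))

smith-∣ : ∀ {n} {M M′ D E : Matrix n n} → IsSmithNormalForm M D → IsSmithNormalForm M′ E → D ∼ E →
  ∀ k → D k k ℤ.∣ E k k
smith-∣ {n} {D = D} {E} snfD snfE ⟨ P , Q , _ , _ , eq ⟩ k = conclude
  where
  open ≡-Reasoning
  -- The conditions on `x` as one square system: rows before `k` ask that `Q x` vanish there, rows
  -- after `k` ask this of `x` itself. Row `k` is left zero, which makes the system singular.
  K : Matrix n n
  K i j with ℕ.<-cmp (toℕ i) (toℕ k)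
  ... | tri< _ _ _ = Q i j
  ... | tri≈ _ _ _ = 0ℤ
  ... | tri> _ _ _ = 𝟙 i j
  K-zero : ∀ j → K k j ≡ 0ℤ
  K-zero j with ℕ.<-cmp (toℕ k) (toℕ k)
  ... | tri< lt _ _ = contradiction lt (ℕ.<-irrefl refl)
  ... | tri≈ _ _ _  = refl
  ... | tri> _ _ gt = contradiction gt (ℕ.<-irrefl refl)
  ker = zeroRow⇒kernel K k K-zero
  x = proj₁ ker
  c = proj₁ (proj₂ ker)
  c·x≡1 = proj₁ (proj₂ (proj₂ ker))
  Kx≡0 = proj₂ (proj₂ (proj₂ ker))
  Qx≡0 : ∀ i → toℕ i ℕ.< toℕ k → (Q ⊙ x) i ≡ 0ℤ
  Qx≡0 i lt with ℕ.<-cmp (toℕ i) (toℕ k) | Kx≡0 i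
  ... | tri< _ _ _  | eq = eq
  ... | tri≈ ≮ _ _  | _  = contradiction lt ≮
  ... | tri> ≮ _ _  | _  = contradiction lt ≮
  x≡0 : ∀ i → toℕ k ℕ.< toℕ i → x i ≡ 0ℤ
  x≡0 i gt with ℕ.<-cmp (toℕ i) (toℕ k) | Kx≡0 i
  ... | tri< _ _ ≯  | _  = contradiction gt ≯
  ... | tri≈ _ _ ≯  | _  = contradiction gt ≯
  ... | tri> _ _ _  | eq = trans (sym (sum-𝟙 i x)) eq
  row : ∀ {M N : Matrix n n} → IsSmithNormalForm M N → ∀ y i → (N ⊙ y) i ≡ N i i * y i
  row {N = N} snf y i = begin
    sum (λ l → N i l * y l)              ≡⟨ sum-cong-≗ {n} (λ l → pick l) ⟩
    sum (λ l → 𝟙 i l * (N i l * y l))    ≡⟨ sum-𝟙 i (λ l → N i l * y l) ⟩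
    N i i * y i                          ∎
    where
    pick : ∀ l → N i l * y l ≡ 𝟙 i l * (N i l * y l)
    pick l with i Fin.≟ l
    ... | yes _  = sym (ℤ.*-identityˡ (N i l * y l))
    ... | no i≢l = cong (_* y l) (diagonal snf i l (i≢l ∘ Fin.toℕ-injective))
  DQx : ∀ l → D k k ℤ.∣ (D ⊙ (Q ⊙ x)) l
  DQx l = subst (D k k ℤ.∣_) (sym (row snfD (Q ⊙ x) l)) (cases (ℕ.<-≤-connex (toℕ l) (toℕ k)))
    where
    cases : toℕ l ℕ.< toℕ k ⊎ toℕ k ℕ.≤ toℕ l → D k k ℤ.∣ D l l * (Q ⊙ x) l
    cases (inj₁ lt) = ℤ.∣n⇒∣m*n (D l l) (subst (D k k ℤ.∣_) (sym (Qx≡0 l lt)) (ℤ.divides 0ℤ refl))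
    cases (inj₂ le) = ℤ.∣m⇒∣m*n ((Q ⊙ x) l) (smith-chain snfD le)
  Ex : ∀ i → D k k ℤ.∣ E i i * x i
  Ex i = subst (D k k ℤ.∣_) (begin
    (P ⊙ (D ⊙ (Q ⊙ x))) i    ≡⟨ ⊙-assoc P D (Q ⊙ x) i ⟨
    ((P · D) ⊙ (Q ⊙ x)) i    ≡⟨ ⊙-assoc (P · D) Q x i ⟨
    (((P · D) · Q) ⊙ x) i    ≡⟨ sum-cong-≗ {n} (λ l → cong (_* x l) (eq i l)) ⟩
    (E ⊙ x) i                ≡⟨ row snfE x i ⟩
    E i i * x i              ∎)
    (∣-sum (λ l → ℤ.∣n⇒∣m*n (P i l) (DQx l)))
  -- The chain for `i ≤ k` and `x i = 0` beyond put the same factor `E k k` into every coordinate,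
  -- so that the Bézout coefficients can remove `x`.
  Eₖx : ∀ i → D k k ℤ.∣ E k k * x i
  Eₖx i with ℕ.<-≤-connex (toℕ k) (toℕ i)
  ... | inj₁ gt = ℤ.∣n⇒∣m*n (E k k) (subst (D k k ℤ.∣_) (sym (x≡0 i gt)) (ℤ.divides 0ℤ refl))
  ... | inj₂ le = ℤ.∣-trans (Ex i) (ℤ.*-monoˡ-∣ (x i) (smith-chain snfE le))
  conclude : D k k ℤ.∣ E k k
  conclude = subst (D k k ℤ.∣_) (begin
    sum (λ i → c i * (E k k * x i))      ≡⟨ sum-cong-≗ {n} (λ i → lemma (c i) (E k k) (x i)) ⟩
    sum (λ i → E k k * (c i * x i))      ≡⟨ *-distribˡ-sum (E k k) (λ i → c i * x i) ⟨
    E k k * sum (λ i → c i * x i)        ≡⟨ cong (E k k *_) c·x≡1 ⟩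
    E k k * 1ℤ                           ≡⟨ ℤ.*-identityʳ (E k k) ⟩
    E k k                                ∎)
    (∣-sum (λ i → ℤ.∣n⇒∣m*n (c i) (Eₖx i)))
    where
    lemma : ∀ a b c → a * (b * c) ≡ b * (a * c)
    lemma = solve-∀

nonNegative-antisym : ∀ {a b} → 0ℤ ℤ.≤ a → 0ℤ ℤ.≤ b → a ℤ.∣ b → b ℤ.∣ a → a ≡ b
nonNegative-antisym (ℤ.+≤+ _) (ℤ.+≤+ _) a∣b b∣a = cong ℤ.+_ (ℕ.∣-antisym (ℤ.∣⇒∣ᵤ a∣b) (ℤ.∣⇒∣ᵤ b∣a))

smith-unique : ∀ {n} {M D E : Matrix n n} → IsSmithNormalForm M D → IsSmithNormalForm M E → E ≈ D
smith-unique {D = D} {E} snfD snfE i j with i Fin.≟ j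
... | no i≢j   = trans (diagonal snfE i j (i≢j ∘ Fin.toℕ-injective)) (sym (diagonal snfD i j (i≢j ∘ Fin.toℕ-injective)))
... | yes refl = nonNegative-antisym (nonNegative snfE i i refl) (nonNegative snfD i i refl)
  (smith-∣ snfE snfD (∼-sym D∼E) i) (smith-∣ snfD snfE D∼E i)
  where
  D∼E : D ∼ E
  D∼E = ∼-trans (∼-sym ⟨ equivalent snfD ⟩) ⟨ equivalent snfE ⟩

smith-∼ : ∀ {n} {M N : Matrix n n} → M ∼ N → ∃[ D ] (S[ M ]≈ D) × (S[ N ]≈ D)
smith-∼ {n} {M} {N} M∼N with smith n n M
... | D , snf = D , normalForm snf , normalForm (record
    { equivalent  = equivalence (∼-trans (∼-sym M∼N) ⟨ equivalent snf ⟩)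
    ; diagonal    = diagonal snf
    ; nonNegative = nonNegative snf
    ; divisible   = divisible snf
    })
  where
  normalForm : ∀ {M : Matrix n n} → IsSmithNormalForm M D → S[ M ]≈ D
  normalForm snf = record { isSmithNormalForm = snf ; unique = λ E → smith-unique snf }

-- Polynomials acting on integer sequences

Seq : Set
Seq = ℕ → ℤ

-- f(S) h, where S is the shift (S h) j = h (j + 1).
act : Poly → Seq → Seq
act []      h j = 0ℤ
act (a ∷ f) h j = a * h j + act f h (suc j)

Ker : Poly → Seq → Set
Ker f h = ∀ j → act f h j ≡ 0ℤ

Periodic : ℕ → Seq → Set
Periodic s h = ∀ j → h (s ℕ.+ j) ≡ h j

act-cong : ∀ f {h h′} → h ≗ h′ → act f h ≗ act f h′
act-cong []      eq j = refl
act-cong (a ∷ f) eq j = cong₂ (λ x y → a * x + y) (eq j) (act-cong f eq (suc j))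

act-0 : ∀ f {h} → (∀ j → h j ≡ 0ℤ) → Ker f h
act-0 []      eq j = refl
act-0 (a ∷ f) eq j = cong₂ _+_ (trans (cong (a *_) (eq j)) (ℤ.*-zeroʳ a)) (act-0 f eq (suc j))

act-shift : ∀ f h s j → act f (λ i → h (s ℕ.+ i)) j ≡ act f h (s ℕ.+ j)
act-shift []      h s j = refl
act-shift (a ∷ f) h s j = cong ((a * h (s ℕ.+ j)) +_)
  (trans (act-shift f h s (suc j)) (cong (act f h) (ℕ.+-suc s j)))

act-linear : ∀ f b c h h′ j →
  act f (λ i → b * h i + c * h′ i) j ≡ b * act f h j + c * act f h′ j
act-linear []      b c h h′ j = lemma b c
  where
  lemma : ∀ b c → 0ℤ ≡ b * 0ℤ + c * 0ℤ
  lemma = solve-∀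
act-linear (a ∷ f) b c h h′ j =
  trans (cong ((a * (b * h j + c * h′ j)) +_) (act-linear f b c h h′ (suc j)))
        (lemma a b c (h j) (h′ j) (act f h (suc j)) (act f h′ (suc j)))
  where
  lemma : ∀ a b c x y u v →
    a * (b * x + c * y) + (b * u + c * v) ≡ b * (a * x + u) + c * (a * y + v)
  lemma = solve-∀

act-+ : ∀ f h h′ j → act f (λ i → h i + h′ i) j ≡ act f h j + act f h′ j
act-+ f h h′ j = begin
  act f (λ i → h i + h′ i) j              ≡⟨ act-cong f (λ i → sym (one (h i) (h′ i))) j ⟩
  act f (λ i → 1ℤ * h i + 1ℤ * h′ i) j    ≡⟨ act-linear f 1ℤ 1ℤ h h′ j ⟩
  1ℤ * act f h j + 1ℤ * act f h′ j        ≡⟨ one (act f h j) (act f h′ j) ⟩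
  act f h j + act f h′ j                  ∎
  where
  open ≡-Reasoning
  one : ∀ x y → 1ℤ * x + 1ℤ * y ≡ x + y
  one = solve-∀

act-- : ∀ f h h′ j → act f (λ i → h i - h′ i) j ≡ act f h j - act f h′ j
act-- f h h′ j = begin
  act f (λ i → h i - h′ i) j               ≡⟨ act-cong f (λ i → sym (one (h i) (h′ i))) j ⟩
  act f (λ i → 1ℤ * h i + -1ℤ * h′ i) j    ≡⟨ act-linear f 1ℤ -1ℤ h h′ j ⟩
  1ℤ * act f h j + -1ℤ * act f h′ j        ≡⟨ one (act f h j) (act f h′ j) ⟩
  act f h j - act f h′ j                   ∎
  where
  open ≡-Reasoning
  one : ∀ x y → 1ℤ * x + -1ℤ * y ≡ x - y
  one = solve-∀

act-* : ∀ f c h j → act f (λ i → c * h i) j ≡ c * act f h j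
act-* []      c h j = sym (ℤ.*-zeroʳ c)
act-* (a ∷ f) c h j = trans (cong ((a * (c * h j)) +_) (act-* f c h (suc j))) (lemma a c (h j) (act f h (suc j)))
  where
  lemma : ∀ a c x y → a * (c * x) + c * y ≡ c * (a * x + y)
  lemma = solve-∀

act-comm : ∀ f g h j → act f (act g h) j ≡ act g (act f h) j
act-comm []      g h j = sym (act-0 g (λ _ → refl) j)
act-comm (a ∷ f) g h j = sym (begin
  act g (λ i → a * h i + act f h (suc i)) j               ≡⟨ act-+ g (λ i → a * h i) (λ i → act f h (suc i)) j ⟩
  act g (λ i → a * h i) j + act g (λ i → act f h (suc i)) j
    ≡⟨ cong₂ _+_ (act-* g a h j) (act-shift g (act f h) 1 j) ⟩
  a * act g h j + act g (act f h) (suc j)                 ≡⟨ cong ((a * act g h j) +_) (sym (act-comm f g h (suc j))) ⟩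
  a * act g h j + act f (act g h) (suc j)                 ∎)
  where open ≡-Reasoning

act-+ₚ : ∀ f g h j → act (f +ₚ g) h j ≡ act f h j + act g h j
act-+ₚ []      g       h j = sym (ℤ.+-identityˡ _)
act-+ₚ (a ∷ f) []      h j = sym (ℤ.+-identityʳ _)
act-+ₚ (a ∷ f) (b ∷ g) h j =
  trans (cong (((a + b) * h j) +_) (act-+ₚ f g h (suc j)))
        (lemma a b (h j) (act f h (suc j)) (act g h (suc j)))
  where
  lemma : ∀ a b x u v → (a + b) * x + (u + v) ≡ (a * x + u) + (b * x + v)
  lemma = solve-∀

act-map : ∀ a g h j → act (map (a *_) g) h j ≡ a * act g h j
act-map a []      h j = sym (ℤ.*-zeroʳ a)
act-map a (b ∷ g) h j =
  trans (cong ((a * b * h j) +_) (act-map a g h (suc j))) (lemma a b (h j) (act g h (suc j)))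
  where
  lemma : ∀ a b x u → a * b * x + a * u ≡ a * (b * x + u)
  lemma = solve-∀

act-*ₚ : ∀ f g h j → act (f *ₚ g) h j ≡ act f (act g h) j
act-*ₚ []      g h j = refl
act-*ₚ (a ∷ f) g h j = trans (act-+ₚ (map (a *_) g) (0ℤ ∷ f *ₚ g) h j)
  (cong₂ _+_ (act-map a g h j) (trans (ℤ.+-identityˡ _) (act-*ₚ f g h (suc j))))

act-1 : ∀ h j → act (1ℤ ∷ []) h j ≡ h j
act-1 h j = trans (ℤ.+-identityʳ _) (ℤ.*-identityˡ _)

act-++ : ∀ f g h j → act (f ++ g) h j ≡ act f h j + act g h (length f ℕ.+ j)
act-++ []      g h j = sym (ℤ.+-identityˡ _)
act-++ (a ∷ f) g h j = trans
  (cong ((a * h j) +_) (trans (act-++ f g h (suc j)) (cong (λ i → act f h (suc j) + act g h i) (ℕ.+-suc (length f) j))))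
  (sym (ℤ.+-assoc (a * h j) _ _))

act-∷ʳ : ∀ f c h j → act (f ∷ʳ c) h j ≡ act f h j + c * h (length f ℕ.+ j)
act-∷ʳ f c h j = trans (act-++ f (c ∷ []) h j) (cong (λ x → act f h j + x) (ℤ.+-identityʳ _))

act-X^ : ∀ n h j → act (X^ n) h j ≡ h (n ℕ.+ j)
act-X^ zero    h j = act-1 h j
act-X^ (suc n) h j = trans (ℤ.+-identityˡ _) (trans (act-X^ n h (suc j)) (cong h (ℕ.+-suc n j)))

act-Xⁿ-1 : ∀ n h j → act (X^ n +ₚ (-1ℤ ∷ [])) h j ≡ h (n ℕ.+ j) - h j
act-Xⁿ-1 n h j = trans (act-+ₚ (X^ n) (-1ℤ ∷ []) h j) (cong₂ _+_ (act-X^ n h j) (lemma (h j)))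
  where
  lemma : ∀ x → -1ℤ * x + 0ℤ ≡ - x
  lemma = solve-∀

Periodic⇒Ker : ∀ n {h} → Periodic n h → Ker (X^ n +ₚ (-1ℤ ∷ [])) h
Periodic⇒Ker n {h} per j = trans (act-Xⁿ-1 n h j) (ℤ.i≡j⇒i-j≡0 (per j))

length-∷ʳ : ∀ (f : Poly) c → length (f ∷ʳ c) ≡ suc (length f)
length-∷ʳ f c = trans (List.length-++ f) (ℕ.+-comm (length f) 1)

-- Division by a monic polynomial

monic : ∀ {e} → Vec ℤ e → Poly
monic p = toList p ∷ʳ 1ℤ

act-toList-∷ʳ : ∀ {e} (v : Vec ℤ e) c h j → act (toList v ∷ʳ c) h j ≡ act (toList v) h j + c * h (e ℕ.+ j)
act-toList-∷ʳ {e} v c h j = trans (act-∷ʳ (toList v) c h j) (cong (λ l → act (toList v) h j + c * h (l ℕ.+ j)) (Vec.length-toList v))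

act-monic : ∀ {e} (p : Vec ℤ e) h j → act (monic p) h j ≡ act (toList p) h j + h (e ℕ.+ j)
act-monic p h j = trans (act-toList-∷ʳ p 1ℤ h j) (cong (act (toList p) h j +_) (ℤ.*-identityˡ _))

toList-init-last : ∀ {e} (s : Vec ℤ (suc e)) → toList s ≡ toList (Vec.init s) ∷ʳ Vec.last s
toList-init-last s = trans (cong toList (proj₂ (proj₂ (Vec.initLast s)))) (Vec.toList-∷ʳ _ (Vec.init s))

act-zipWith : ∀ {e} t (u p : Vec ℤ e) h j →
  act (toList (Vec.zipWith (λ a b → a - t * b) u p)) h j ≡ act (toList u) h j - t * act (toList p) h j
act-zipWith t []      []      h j = lemma t
  where
  lemma : ∀ t → 0ℤ ≡ 0ℤ - t * 0ℤ
  lemma = solve-∀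
act-zipWith t (a ∷ u) (b ∷ p) h j =
  trans (cong (((a - t * b) * h j) +_) (act-zipWith t u p h (suc j)))
        (lemma t a b (h j) (act (toList u) h (suc j)) (act (toList p) h (suc j)))
  where
  lemma : ∀ t a b x u v → (a - t * b) * x + (u - t * v) ≡ (a * x + u) - t * (b * x + v)
  lemma = solve-∀

-- The identity `f = q P + r` as an equality of operators, which is insensitive to the zeros that
-- pad `q` and `r`.
divModMonic-spec : ∀ {e} (p : Vec ℤ e) f h j → let q , r = divModMonic p f in
  act f h j ≡ act q (act (monic p) h) j + act (toList r) h j
divModMonic-spec {e} p [] h j = sym (trans (ℤ.+-identityˡ _) (zeros e j))
  where
  zeros : ∀ e j → act (toList (Vec.replicate e 0ℤ)) h j ≡ 0ℤ
  zeros zero    j = refl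
  zeros (suc e) j = trans (ℤ.+-identityˡ _) (zeros e (suc j))
divModMonic-spec {e} p (c ∷ f) h j = begin
  c * h j + act f h (suc j)
    ≡⟨ cong ((c * h j) +_) (divModMonic-spec p f h (suc j)) ⟩
  c * h j + (Q + act (toList r) h (suc j))
    ≡⟨ swap (c * h j) Q _ ⟩
  Q + act (toList s) h j
    ≡⟨ cong (Q +_) (trans (cong (λ l → act l h j) (toList-init-last s)) (act-toList-∷ʳ (Vec.init s) t h j)) ⟩
  Q + (act (toList (Vec.init s)) h j + t * h (e ℕ.+ j))
    ≡⟨ regroup Q (act (toList (Vec.init s)) h j) t (h (e ℕ.+ j)) (act (toList p) h j) ⟩
  t * (act (toList p) h j + h (e ℕ.+ j)) + Q + (act (toList (Vec.init s)) h j - t * act (toList p) h j)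
    ≡⟨ sym (cong₂ (λ x y → t * x + Q + y) (act-monic p h j) (act-zipWith t (Vec.init s) p h j)) ⟩
  t * act (monic p) h j + Q + act (toList (Vec.zipWith (λ a b → a - t * b) (Vec.init s) p)) h j ∎
  where
  open ≡-Reasoning
  q = proj₁ (divModMonic p f)
  r = proj₂ (divModMonic p f)
  s = c ∷ r
  t = Vec.last s
  Q = act q (act (monic p) h) (suc j)
  swap : ∀ x y z → x + (y + z) ≡ y + (x + z)
  swap = solve-∀
  regroup : ∀ Q i t x p → Q + (i + t * x) ≡ t * (p + x) + Q + (i - t * p)
  regroup = solve-∀

coeff-beyond : ∀ f {i} → length f ℕ.≤ i → coeff f i ≡ 0ℤ
coeff-beyond []      le       = refl
coeff-beyond (a ∷ f) (s≤s le) = coeff-beyond f le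

coeff-∷ʳ : ∀ f c → coeff (f ∷ʳ c) (length f) ≡ c
coeff-∷ʳ []      c = refl
coeff-∷ʳ (a ∷ f) c = coeff-∷ʳ f c

coeffs : ∀ e → Seq → Vec ℤ e
coeffs e g = tabulate (λ i → g (toℕ i))

last-coeffs : ∀ e g → Vec.last (coeffs (suc e) g) ≡ g e
last-coeffs zero    g = refl
last-coeffs (suc e) g = last-coeffs e (g ∘ suc)

init-coeffs : ∀ e g → Vec.init (coeffs (suc e) g) ≡ coeffs e g
init-coeffs zero    g = refl
init-coeffs (suc e) g = cong (g 0 ∷_) (init-coeffs e (g ∘ suc))

coeffs-0 : ∀ e → Vec.replicate e 0ℤ ≡ coeffs e (λ _ → 0ℤ)
coeffs-0 zero    = refl
coeffs-0 (suc e) = cong (0ℤ ∷_) (coeffs-0 e)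

zipWith-0 : ∀ {e} t (u p : Vec ℤ e) → t ≡ 0ℤ → Vec.zipWith (λ a b → a - t * b) u p ≡ u
zipWith-0 t []      []      eq = refl
zipWith-0 t (a ∷ u) (b ∷ p) eq = cong₂ _∷_ (trans (cong (λ t → a - t * b) eq) (ℤ.+-identityʳ a)) (zipWith-0 t u p eq)

-- Below the degree of the divisor nothing is subtracted, yet the quotient is a list of zeros and
-- not `[]`; hence the formulation through `act`.
divModMonic-short : ∀ {e} (p : Vec ℤ e) f → length f ℕ.≤ e → let q , r = divModMonic p f in
  (∀ h j → act q h j ≡ 0ℤ) × r ≡ coeffs e (coeff f)
divModMonic-short {e} p []      le = (λ h j → refl) , coeffs-0 e
divModMonic-short {e} p (c ∷ f) le =
  (λ h j → cong₂ _+_ (cong (_* h j) t≡0) (proj₁ ih h (suc j))) ,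
  trans (zipWith-0 _ _ p t≡0) (trans (cong (λ r → Vec.init (c ∷ r)) (proj₂ ih)) (init-coeffs e (coeff (c ∷ f))))
  where
  ih = divModMonic-short p f (ℕ.≤-trans (ℕ.n≤1+n _) le)
  t≡0 : Vec.last (c ∷ proj₂ (divModMonic p f)) ≡ 0ℤ
  t≡0 = trans (cong (λ r → Vec.last (c ∷ r)) (proj₂ ih)) (trans (last-coeffs e (coeff (c ∷ f))) (coeff-beyond (c ∷ f) le))

-- The entries cut off form the quotient of a tail of `f` of length at most `e`, which acts as zero
-- by `divModMonic-short`.
act-take-quotient : ∀ {e} (p : Vec ℤ e) f h j → let q = proj₁ (divModMonic p f) in
  act (take (length f ∸ e) q) h j ≡ act q h j
act-take-quotient {e} p [] h j = cong (λ l → act l h j) (List.take-[] (0 ∸ e))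
act-take-quotient {e} p (c ∷ f) h j with ℕ.<-≤-connex (length f) e
... | inj₁ lt = trans (cong (λ n → act (take n (proj₁ (divModMonic p (c ∷ f)))) h j) (ℕ.m≤n⇒m∸n≡0 lt))
                      (sym (proj₁ (divModMonic-short p (c ∷ f) lt) h j))
... | inj₂ le rewrite ℕ.+-∸-assoc 1 le = cong ((Vec.last (c ∷ proj₂ (divModMonic p f)) * h j) +_) (act-take-quotient p f h (suc j))

quotient-monic : ∀ {e} (p : Vec ℤ e) f → e ℕ.≤ length f → let q = proj₁ (divModMonic p (f ∷ʳ 1ℤ)) in
  ∃[ l ] take (length (f ∷ʳ 1ℤ) ∸ e) q ≡ l ∷ʳ 1ℤ × length l ≡ length f ∸ e
quotient-monic [] [] z≤n = [] , refl , refl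
quotient-monic {e} p (c ∷ f) le with ℕ.m≤n⇒m<n∨m≡n le
... | inj₁ (s≤s lt) rewrite ℕ.+-∸-assoc 1 (ℕ.≤-trans lt (ℕ.≤-trans (ℕ.n≤1+n _) (ℕ.≤-reflexive (sym (length-∷ʳ f 1ℤ)))))
                          | ℕ.+-∸-assoc 1 lt =
  let t           = Vec.last (c ∷ proj₂ (divModMonic p (f ∷ʳ 1ℤ)))
      l , eq , len = quotient-monic p f lt
  in t ∷ l , cong (t ∷_) eq , cong suc len
-- Dividend and divisor have equal degree: the quotient is a single entry, and the leading 1 reaches
-- the position of `Xᵉ` unaltered.
... | inj₂ refl rewrite length-∷ʳ f 1ℤ | ℕ.m+n∸n≡m 1 (length f) | ℕ.n∸n≡0 (length f) =
  [] , cong (_∷ []) (trans (cong (λ r → Vec.last (c ∷ r)) (proj₂ (divModMonic-short p (f ∷ʳ 1ℤ) (ℕ.≤-reflexive (length-∷ʳ f 1ℤ)))))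
                     (trans (last-coeffs e (coeff (c ∷ f ∷ʳ 1ℤ))) (coeff-∷ʳ f 1ℤ))) , refl

-- Solutions of linear recurrences

window : ∀ {e} → Vec ℤ e → Vec ℤ e → Vec ℤ (suc e)
window p v = v Vec.∷ʳ (- act (toList p) (coeff (toList v)) 0)

-- `window` appends to the initial terms the one term that the recurrence with characteristic
-- polynomial `monic p` forces. Its tail supplies the next initial terms, so a shifted solution is
-- again a `solution`.
solution : ∀ {e} → Vec ℤ e → Vec ℤ e → Seq
solution p v zero    = Vec.head (window p v)
solution p v (suc j) = solution p (Vec.tail (window p v)) j

coeff-head : ∀ {e} (v : Vec ℤ (suc e)) → coeff (toList v) 0 ≡ Vec.head v
coeff-head (a ∷ v) = refl

coeff-tail : ∀ {e} (v : Vec ℤ (suc e)) i → coeff (toList v) (suc i) ≡ coeff (toList (Vec.tail v)) i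
coeff-tail (a ∷ v) i = refl

coeff-++ˡ : ∀ f {g i} → i ℕ.< length f → coeff (f ++ g) i ≡ coeff f i
coeff-++ˡ (a ∷ f) {i = zero}  lt       = refl
coeff-++ˡ (a ∷ f) {i = suc i} (s≤s lt) = coeff-++ˡ f lt

coeff-toList-∷ʳ : ∀ {e} (v : Vec ℤ e) c {i} → i ℕ.< e → coeff (toList (v Vec.∷ʳ c)) i ≡ coeff (toList v) i
coeff-toList-∷ʳ v c lt = trans (cong (λ l → coeff l _) (Vec.toList-∷ʳ c v))
  (coeff-++ˡ (toList v) (ℕ.≤-trans lt (ℕ.≤-reflexive (sym (Vec.length-toList v)))))

solution-initial : ∀ {e} (p v : Vec ℤ e) {j} → j ℕ.< e → solution p v j ≡ coeff (toList v) j
solution-window : ∀ {e} (p v : Vec ℤ e) {j} → j ℕ.≤ e → solution p v j ≡ coeff (toList (window p v)) j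

solution-initial p v lt = trans (solution-window p v (ℕ.<⇒≤ lt)) (coeff-toList-∷ʳ v _ lt)
solution-window p v {zero}  le = sym (coeff-head (window p v))
solution-window p v {suc j} le =
  trans (solution-initial p (Vec.tail (window p v)) le) (sym (coeff-tail (window p v) j))

act-cong-< : ∀ f {h h′} j → (∀ {i} → i ℕ.< length f ℕ.+ j → h i ≡ h′ i) → act f h j ≡ act f h′ j
act-cong-< []      j eq = refl
act-cong-< (a ∷ f) j eq = cong₂ (λ x y → a * x + y) (eq (s≤s (ℕ.m≤n+m j (length f))))
  (act-cong-< f (suc j) (λ lt → eq (ℕ.≤-trans lt (ℕ.≤-reflexive (ℕ.+-suc (length f) j)))))

coeff-last : ∀ {e} (v : Vec ℤ e) c → coeff (toList (v Vec.∷ʳ c)) e ≡ c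
coeff-last []      c = refl
coeff-last (a ∷ v) c = coeff-last v c

solution-solves : ∀ {e} (p v : Vec ℤ e) → act (monic p) (solution p v) ≗ (λ _ → 0ℤ)
solution-solves {e} p v zero = begin
  act (monic p) (solution p v) 0
    ≡⟨ act-monic p (solution p v) 0 ⟩
  act (toList p) (solution p v) 0 + solution p v (e ℕ.+ 0)
    ≡⟨ cong₂ _+_
         (act-cong-< (toList p) 0 (λ lt → solution-initial p v (ℕ.≤-trans lt (ℕ.≤-reflexive (trans (ℕ.+-identityʳ _) (Vec.length-toList p))))))
         (trans (cong (solution p v) (ℕ.+-identityʳ e)) (trans (solution-window p v ℕ.≤-refl) (coeff-last v _))) ⟩
  act (toList p) (coeff (toList v)) 0 + (- act (toList p) (coeff (toList v)) 0)
    ≡⟨ ℤ.+-inverseʳ (act (toList p) (coeff (toList v)) 0) ⟩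
  0ℤ ∎
  where
  open ≡-Reasoning
solution-solves p v (suc j) = trans (sym (act-shift (monic p) (solution p v) 1 j))
  (solution-solves p (Vec.tail (window p v)) j)

Monic : Poly → ℕ → Set
Monic f e = ∃[ l ] f ≡ l ∷ʳ 1ℤ × length l ≡ e

Monic-deg : ∀ {f e} → Monic f e → deg f ≡ e
Monic-deg (l , refl , len) = trans (cong pred (length-∷ʳ l 1ℤ)) len

monic-lowerCoeffs : ∀ {f e} → Monic f e → monic (lowerCoeffs f) ≡ f
monic-lowerCoeffs (l , refl , _) = cong (_∷ʳ 1ℤ) (lower (deg (l ∷ʳ 1ℤ)) l (sym (cong pred (length-∷ʳ l 1ℤ))))
  where
  lower : ∀ n l → length l ≡ n → toList (coeffs n (coeff (l ∷ʳ 1ℤ))) ≡ l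
  lower zero    []      eq = refl
  lower (suc n) (a ∷ l) eq = cong (a ∷_) (lower n l (ℕ.suc-injective eq))

δ : ℕ → Seq
δ zero    zero    = 1ℤ
δ zero    (suc j) = 0ℤ
δ (suc i) zero    = 0ℤ
δ (suc i) (suc j) = δ i j

act-δ : ∀ f i → act f (δ i) 0 ≡ coeff f i
act-δ []      i       = refl
act-δ (a ∷ f) zero    = trans (cong₂ _+_ (ℤ.*-identityʳ a) (trans (sym (act-shift f (δ 0) 1 0)) (act-0 f (λ _ → refl) 0)))
                              (ℤ.+-identityʳ a)
act-δ (a ∷ f) (suc i) = trans (cong₂ _+_ (ℤ.*-zeroʳ a) (trans (sym (act-shift f (δ (suc i)) 1 0)) (act-δ f i)))
                              (ℤ.+-identityˡ _)

coeff-coeffs : ∀ {e i} h → i ℕ.< e → coeff (toList (coeffs e h)) i ≡ h i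
coeff-coeffs {i = zero}  h (s≤s lt) = refl
coeff-coeffs {i = suc i} h (s≤s lt) = coeff-coeffs (h ∘ suc) lt

-- The basis of `Ker P` dual to the classes `1, X, X², …`: by `coeff-mod`, term `j` of `basis P i`
-- is coordinate `i` of `Xʲ` modulo `P`, for `i` below the degree.
basis : Poly → ℕ → Seq
basis P i = solution (lowerCoeffs P) (coeffs (deg P) (δ i))

basis-Ker : ∀ {P e} → Monic P e → ∀ i → Ker P (basis P i)
basis-Ker {P} mon i j = trans (cong (λ Q → act Q (basis P i) j) (sym (monic-lowerCoeffs mon))) (solution-solves (lowerCoeffs P) _ j)

basis-initial : ∀ P i {j} → j ℕ.< deg P → basis P i j ≡ δ i j
basis-initial P i lt = trans (solution-initial (lowerCoeffs P) _ lt) (coeff-coeffs (δ i) lt)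

act-mod : ∀ {P e} → Monic P e → ∀ f {h} → Ker P h → act f h 0 ≡ act (f mod P) h 0
act-mod {P} mon f {h} ker = trans (divModMonic-spec (lowerCoeffs P) f h 0)
  (trans (cong (_+ act (f mod P) h 0)
    (act-0 (proj₁ (divModMonic (lowerCoeffs P) f)) (λ j → trans (cong (λ Q → act Q h j) (monic-lowerCoeffs mon)) (ker j)) 0))
  (ℤ.+-identityˡ _))

length-mod : ∀ f P → length (f mod P) ≡ deg P
length-mod f P = Vec.length-toList (proj₂ (divModMonic (lowerCoeffs P) f))

coeff-mod : ∀ {P e} → Monic P e → ∀ f {i} → i ℕ.< deg P → coeff (f mod P) i ≡ act f (basis P i) 0
coeff-mod {P} mon f {i} lt = begin
  coeff (f mod P) i              ≡⟨ act-δ (f mod P) i ⟨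
  act (f mod P) (δ i) 0          ≡⟨ act-cong-< (f mod P) 0 (λ lt → sym (basis-initial P i (ℕ.≤-trans lt (ℕ.≤-reflexive (trans (ℕ.+-identityʳ _) (length-mod f P)))))) ⟩
  act (f mod P) (basis P i) 0    ≡⟨ act-mod mon f (basis-Ker mon i) ⟨
  act f (basis P i) 0            ∎
  where open ≡-Reasoning

act-zero : ∀ f → (∀ i → i ℕ.< length f → coeff f i ≡ 0ℤ) → ∀ h → Ker f h
act-zero []      eq h j = refl
act-zero (a ∷ f) eq h j = cong₂ (λ a x → a * h j + x) (eq 0 (s≤s z≤n)) (act-zero f (λ i lt → eq (suc i) (s≤s lt)) h (suc j))

module _ {P e} (mon : Monic P e) (f : Poly) (ker⊆ker : ∀ {h} → Ker P h → Ker f h) where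

  -- Each coefficient of the remainder is the value of `f(S)` on a basis sequence of `Ker P`, and by
  -- assumption `f` kills those. Inclusion of kernels thus plays the part of divisibility.
  mod-vanishes : ∀ {i} → i ℕ.< deg P → coeff (f mod P) i ≡ 0ℤ
  mod-vanishes {i} lt = trans (coeff-mod mon f lt) (ker⊆ker (basis-Ker mon i) 0)

  div-exact : ∀ h j → act f h j ≡ act (f div P) (act P h) j
  div-exact h j = begin
    act f h j                                           ≡⟨ divModMonic-spec (lowerCoeffs P) f h j ⟩
    act q (act (monic (lowerCoeffs P)) h) j + act (f mod P) h j
      ≡⟨ cong₂ _+_ (cong (λ Q → act q (act Q h) j) (monic-lowerCoeffs mon))
                   (act-zero (f mod P) (λ i lt → mod-vanishes (ℕ.≤-trans lt (ℕ.≤-reflexive (length-mod f P)))) h j) ⟩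
    act q (act P h) j + 0ℤ                              ≡⟨ ℤ.+-identityʳ _ ⟩
    act q (act P h) j                                   ≡⟨ act-take-quotient (lowerCoeffs P) f (act P h) j ⟨
    act (f div P) (act P h) j                           ∎
    where
    open ≡-Reasoning
    q = proj₁ (divModMonic (lowerCoeffs P) f)

-- Were the degree of `P` larger, the dividend would be its own remainder, which vanishes although
-- its leading coefficient is 1.
div-monic : ∀ {P e} → Monic P e → ∀ l → (∀ {h} → Ker P h → Ker (l ∷ʳ 1ℤ) h) →
  Monic ((l ∷ʳ 1ℤ) div P) (length l ∸ deg P) × deg P ℕ.≤ length l
div-monic {P} mon l ker⊆ker = quotient-monic (lowerCoeffs P) l deg≤ , deg≤
  where
  deg≤ : deg P ℕ.≤ length l
  deg≤ with ℕ.<-≤-connex (length l) (deg P)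
  ... | inj₂ le = le
  ... | inj₁ lt = contradiction one≡zero λ ()
    where
    open ≡-Reasoning
    one≡zero : 1ℤ ≡ 0ℤ
    one≡zero = begin
      1ℤ                                                  ≡⟨ coeff-∷ʳ l 1ℤ ⟨
      coeff (l ∷ʳ 1ℤ) (length l)                          ≡⟨ coeff-coeffs (coeff (l ∷ʳ 1ℤ)) lt ⟨
      coeff (toList (coeffs (deg P) (coeff (l ∷ʳ 1ℤ)))) (length l)
        ≡⟨ cong (λ r → coeff (toList r) (length l))
             (proj₂ (divModMonic-short (lowerCoeffs P) (l ∷ʳ 1ℤ) (ℕ.≤-trans (ℕ.≤-reflexive (length-∷ʳ l 1ℤ)) lt))) ⟨
      coeff ((l ∷ʳ 1ℤ) mod P) (length l)                  ≡⟨ mod-vanishes mon (l ∷ʳ 1ℤ) ker⊆ker lt ⟩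
      0ℤ                                                  ∎

+ₚ-identityʳ : ∀ f → f +ₚ [] ≡ f
+ₚ-identityʳ []      = refl
+ₚ-identityʳ (a ∷ f) = refl

Monic-+ₚ : ∀ f {g e} → Monic g e → length f ℕ.≤ e → Monic (f +ₚ g) e
Monic-+ₚ []      mon                 le       = mon
Monic-+ₚ (a ∷ f) (b ∷ l , refl , refl) (s≤s le) =
  let l′ , eq , len = Monic-+ₚ f (l , refl , refl) le in a + b ∷ l′ , cong (a + b ∷_) eq , cong suc len

Monic-*ₚ : ∀ {f g d e} → Monic f d → Monic g e → Monic (f *ₚ g) (d ℕ.+ e)
Monic-*ₚ ([] , refl , refl) (l , refl , len) rewrite trans (List.map-cong ℤ.*-identityˡ (l ∷ʳ 1ℤ)) (List.map-id (l ∷ʳ 1ℤ)) =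
  plus-zero l len
  where
  plus-zero : ∀ l {e} → length l ≡ e → Monic ((l ∷ʳ 1ℤ) +ₚ (0ℤ ∷ [])) e
  plus-zero []      len = [] , refl , len
  plus-zero (a ∷ l) len = a + 0ℤ ∷ l , cong (a + 0ℤ ∷_) (+ₚ-identityʳ (l ∷ʳ 1ℤ)) , len
Monic-*ₚ {g = g} (a ∷ l , refl , refl) mon@(l′ , refl , refl) =
  let k , eq , len = Monic-*ₚ (l , refl , refl) mon in
  Monic-+ₚ (map (a *_) g) (0ℤ ∷ k , cong (0ℤ ∷_) eq , cong suc len)
    (ℕ.≤-trans (ℕ.≤-reflexive (trans (List.length-map (a *_) g) (length-∷ʳ l′ 1ℤ))) (s≤s (ℕ.m≤n+m _ (length l))))

-- Coprimality of complementary factors of `Xⁿ - 1`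

module _ (n : ℕ) .{{_ : ℕ.NonZero n}} (f g : Poly)
         (factor : ∀ h j → h (n ℕ.+ j) - h j ≡ act f (act g h) j) where

  private
    θ : Seq → Seq
    θ h j = ℤ.+ j * h j

    θₚ : ℕ → Poly → Poly
    θₚ k []      = []
    θₚ k (a ∷ f) = ℤ.+ k * a ∷ θₚ (suc k) f

    -- The product rule `f(S) θ = θ f(S) + f̃(S)`, where `f̃ = θₚ 0 f` is `X` times the derivative
    -- of `f`. The offset `k` is the exponent of the first listed coefficient.
    act-θ : ∀ k f h j → act f (θ h) (k ℕ.+ j) ≡ ℤ.+ j * act f h (k ℕ.+ j) + act (θₚ k f) h (k ℕ.+ j)
    act-θ k []      h j = lemma (ℤ.+ j)
      where
      lemma : ∀ j → 0ℤ ≡ j * 0ℤ + 0ℤ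
      lemma = solve-∀
    act-θ k (a ∷ f) h j = trans
      (cong₂ (λ i u → a * (i * h (k ℕ.+ j)) + u) (ℤ.pos-+ k j) (act-θ (suc k) f h j))
      (lemma a (ℤ.+ k) (ℤ.+ j) (h (k ℕ.+ j)) (act f h (suc (k ℕ.+ j))) (act (θₚ (suc k) f) h (suc (k ℕ.+ j))))
      where
      lemma : ∀ a k j x u v → a * ((k + j) * x) + (j * u + v) ≡ j * (a * x + u) + (k * a * x + v)
      lemma = solve-∀

  -- By the product rule, `g(S) h = 0` gives `g(S) θ h = g̃(S) h`, and `f(S)` kills this since it
  -- commutes with `g̃(S)`. So `Sⁿ - 1` kills `θ h`: this is the derivative argument for `Xⁿ - 1`
  -- having no repeated factor.
  ker-cofactors : ∀ {h} → Ker f h → Ker g h → ∀ j → h j ≡ 0ℤ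
  ker-cofactors {h} fh gh j = [ (λ n≡0 → contradiction (ℤ.+-injective n≡0) (ℕ.≢-nonZero⁻¹ n)) , id ]′
      (ℤ.i*j≡0⇒i≡0∨j≡0 (ℤ.+ n) (begin
    ℤ.+ n * h j
      ≡⟨ lemma (ℤ.+ n) (ℤ.+ j) (h j) ⟩
    (ℤ.+ n + ℤ.+ j) * h j - ℤ.+ j * h j
      ≡⟨ cong (_- ℤ.+ j * h j) (cong₂ _*_ (sym (ℤ.pos-+ n j)) (sym periodic)) ⟩
    θ h (n ℕ.+ j) - θ h j
      ≡⟨ factor (θ h) j ⟩
    act f (act g (θ h)) j
      ≡⟨ act-cong f (λ i → trans (act-θ 0 g h i) (trans (cong (λ x → ℤ.+ i * x + act (θₚ 0 g) h i) (gh i)) (cong (_+ act (θₚ 0 g) h i) (ℤ.*-zeroʳ (ℤ.+ i))))) j ⟩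
    act f (λ i → 0ℤ + act (θₚ 0 g) h i) j
      ≡⟨ act-cong f (λ i → ℤ.+-identityˡ _) j ⟩
    act f (act (θₚ 0 g) h) j
      ≡⟨ act-comm f (θₚ 0 g) h j ⟩
    act (θₚ 0 g) (act f h) j
      ≡⟨ act-0 (θₚ 0 g) fh j ⟩
    0ℤ ∎))
    where
    open ≡-Reasoning
    periodic : h (n ℕ.+ j) ≡ h j
    periodic = ℤ.i-j≡0⇒i≡j _ _ (trans (factor h j) (act-0 f gh j))
    lemma : ∀ n j x → n * x ≡ (n + j) * x - j * x
    lemma = solve-∀

-- Periodic sequences

Periodic-* : ∀ {s h} k → Periodic s h → Periodic (k ℕ.* s) h
Periodic-* zero        per j = refl
Periodic-* {s} {h} (suc k) per j =
  trans (cong h (ℕ.+-assoc s (k ℕ.* s) j)) (trans (per (k ℕ.* s ℕ.+ j)) (Periodic-* k per j))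

Periodic-∣ : ∀ {s t h} → s ∣ t → Periodic s h → Periodic t h
Periodic-∣ (divides k refl) per = Periodic-* k per

Periodic-bézout : ∀ {s t g h} x y → g ℕ.+ y ℕ.* t ≡ x ℕ.* s → Periodic s h → Periodic t h → Periodic g h
Periodic-bézout {s} {t} {g} {h} x y eq ps pt j = begin
  h (g ℕ.+ j)                  ≡⟨ Periodic-* y pt (g ℕ.+ j) ⟨
  h (y ℕ.* t ℕ.+ (g ℕ.+ j))    ≡⟨ cong h (ℕ.+-assoc (y ℕ.* t) g j) ⟨
  h (y ℕ.* t ℕ.+ g ℕ.+ j)      ≡⟨ cong (λ i → h (i ℕ.+ j)) (trans (ℕ.+-comm (y ℕ.* t) g) eq) ⟩
  h (x ℕ.* s ℕ.+ j)            ≡⟨ Periodic-* x ps j ⟩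
  h j                          ∎
  where open ≡-Reasoning

Periodic-gcd : ∀ {s t h} → Periodic s h → Periodic t h → Periodic (gcd s t) h
Periodic-gcd {s} {t} ps pt with Bézout.identity (gcd-GCD s t)
... | Bézout.+- x y eq = Periodic-bézout x y eq ps pt
... | Bézout.-+ x y eq = Periodic-bézout y x eq pt ps

-- Kernels of the cyclotomic operators

L : ℕ → Seq → Set
L d = Ker (Φ d)

properDivisors : ℕ → List ℕ
properDivisors n = filter (_∣? n) (range (pred n))

∈-range⁺ : ∀ {n i} → 0 ℕ.< i → i ℕ.≤ n → i ∈ range n
∈-range⁺ {i = suc i} _ le = ∈-map⁺ suc (∈-upTo⁺ le)

∈-range⁻ : ∀ {n i} → i ∈ range n → 0 ℕ.< i × i ℕ.≤ n
∈-range⁻ i∈ with ∈-map⁻ suc i∈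
... | _ , j∈ , refl = s≤s z≤n , ∈-upTo⁻ j∈

range-Unique : ∀ n → Unique (range n)
range-Unique n = Unique.map⁺ ℕ.suc-injective (Unique.upTo⁺ n)

range-∷ʳ : ∀ n → range (suc n) ≡ range n ∷ʳ suc n
range-∷ʳ n = trans (cong (map suc) (sym (List.upTo-∷ʳ n))) (List.map-++ suc (upTo n) _)

∈-properDivisors⁺ : ∀ {n c} → 0 ℕ.< c → c ℕ.< n → c ∣ n → c ∈ properDivisors n
∈-properDivisors⁺ {suc n} 0<c (s≤s c≤n) c∣n = ∈-filter⁺ (_∣? suc n) (∈-range⁺ 0<c c≤n) c∣n

∈-properDivisors⁻ : ∀ {n c} → 0 ℕ.< n → c ∈ properDivisors n → 0 ℕ.< c × c ℕ.< n × c ∣ n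
∈-properDivisors⁻ {suc n} _ c∈ with ∈-filter⁻ (_∣? suc n) {xs = range n} c∈
... | c∈range , c∣n with ∈-range⁻ c∈range
... | 0<c , c≤n = 0<c , s≤s c≤n , c∣n

-- The product of the `Φ d` as a composition of operators, so that a factor can be moved past the
-- others by `actΦ-comm`.
actΦ : List ℕ → Seq → Seq
actΦ ds h = foldr (λ d → act (Φ d)) h ds

actΦ-0 : ∀ ds {h} → (∀ j → h j ≡ 0ℤ) → ∀ j → actΦ ds h j ≡ 0ℤ
actΦ-0 []       eq = eq
actΦ-0 (d ∷ ds) eq = act-0 (Φ d) (actΦ-0 ds eq)

actΦ-comm : ∀ f ds h j → act f (actΦ ds h) j ≡ actΦ ds (act f h) j
actΦ-comm f []       h j = refl
actΦ-comm f (d ∷ ds) h j = trans (act-comm f (Φ d) (actΦ ds h) j) (act-cong (Φ d) (actΦ-comm f ds h) j)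

actΦ-∈ : ∀ {d ds h} → d ∈ ds → L d h → ∀ j → actΦ ds h j ≡ 0ℤ
actΦ-∈ {d} {ds = _ ∷ ds} {h} (here refl) ker j = trans (actΦ-comm (Φ d) ds h j) (actΦ-0 ds ker j)
actΦ-∈ {ds = c ∷ ds}         (there d∈)  ker j = act-0 (Φ c) (actΦ-∈ d∈ ker) j

Φproduct : List ℕ → Poly
Φproduct ds = foldr _*ₚ_ (1ℤ ∷ []) (map Φ ds)

act-Φproduct : ∀ ds h j → act (Φproduct ds) h j ≡ actΦ ds h j
act-Φproduct []       h j = act-1 h j
act-Φproduct (d ∷ ds) h j = trans (act-*ₚ (Φ d) (Φproduct ds) h j) (act-cong (Φ d) (act-Φproduct ds h) j)

-- `W` is stable under all operators and each factor is injective on it, so the factors can be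
-- stripped off one by one.
actΦ-injective : ∀ (W : Seq → Set) → (∀ f {h} → W h → W (act f h)) →
  ∀ {cs} → (∀ {c h} → c ∈ cs → W h → L c h → ∀ j → h j ≡ 0ℤ) →
  ∀ {h} → W h → (∀ j → actΦ cs h j ≡ 0ℤ) → ∀ j → h j ≡ 0ℤ
actΦ-injective W stable {[]}     inj Wh eq = eq
actΦ-injective W stable {c ∷ cs} inj {h} Wh eq =
  actΦ-injective W stable (inj ∘ there) Wh (inj (here refl) (stable* cs) eq)
  where
  stable* : ∀ ds → W (actΦ ds h)
  stable* []       = Wh
  stable* (d ∷ ds) = stable (Φ d) (stable* ds)

-- The factorisation of Xⁿ - 1

-- The invariant of a strong induction. Exactness of the division that defines `Φ n` rests on these
-- facts for smaller indices, which is why the module `Below` assumes them only under a bound.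
record Cyclotomic (n : ℕ) : Set where
  field
    Φ-monic  : Monic (Φ n) (deg (Φ n))
    degrees  : deg (Φ n) ℕ.+ Σ (map (deg ∘ Φ) (properDivisors n)) ≡ n
    factor   : ∀ h j → h (n ℕ.+ j) - h j ≡ act (Φ n) (actΦ (properDivisors n) h) j

  L-periodic : ∀ {h} → L n h → Periodic n h
  L-periodic {h} ker j = ℤ.i-j≡0⇒i≡j _ _ (trans (factor h j)
    (trans (actΦ-comm (Φ n) (properDivisors n) h j) (actΦ-0 (properDivisors n) ker j)))

  factor-periodic : ∀ {h} → Periodic n h → ∀ j → actΦ (n ∷ properDivisors n) h j ≡ 0ℤ
  factor-periodic {h} per j = trans (sym (factor h j)) (ℤ.i≡j⇒i-j≡0 (per j))

  L∩L-properDivisor : ∀ {c h} → 0 ℕ.< n → c ∈ properDivisors n → L n h → L c h → ∀ j → h j ≡ 0ℤ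
  L∩L-properDivisor {h = h} 0<n c∈ Lnh Lch = ker-cofactors n {{ℕ.>-nonZero 0<n}} (Φ n) (Φproduct (properDivisors n))
    (λ h j → trans (factor h j) (sym (act-cong (Φ n) (act-Φproduct (properDivisors n) h) j)))
    Lnh (λ j → trans (act-Φproduct (properDivisors n) h j) (actΦ-∈ c∈ Lch j))

open Cyclotomic

L-stable : ∀ d f {h} → L d h → L d (act f h)
L-stable d f {h} ker j = trans (act-comm (Φ d) f h j) (act-0 f ker j)

module Below (N : ℕ) (cyc : ∀ {d} → 0 ℕ.< d → d ℕ.< N → Cyclotomic d) where

  -- Being also `d`-periodic, `h` has period `g = gcd s d`, a proper divisor of `d`. Hence the
  -- product of `Φ c` over all `c ∣ g` kills it, and each of these factors is injective on `L d`.
  L∩Periodic : ∀ {d s h} → 0 ℕ.< d → d ℕ.< N → ¬ d ∣ s → L d h → Periodic s h → ∀ j → h j ≡ 0ℤ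
  L∩Periodic {d} {s} {h} 0<d d<N d∤s Ldh per =
    actΦ-injective (L d) (L-stable d) {g ∷ properDivisors g}
      (λ c∈ → L∩L-properDivisor (cyc 0<d d<N) 0<d (proper c∈)) Ldh
      (factor-periodic (cyc 0<g (ℕ.<-trans g<d d<N)) (Periodic-gcd per (L-periodic (cyc 0<d d<N) Ldh)))
    where
    g = gcd s d
    0<g : 0 ℕ.< g
    0<g = ℕ.n≢0⇒n>0 (λ g≡0 → ℕ.m<n⇒n≢0 0<d (ℕ.0∣⇒≡0 (subst (_∣ d) g≡0 (gcd[m,n]∣n s d))))
    g<d : g ℕ.< d
    g<d = ℕ.≤∧≢⇒< (ℕ.∣⇒≤ {{ℕ.>-nonZero 0<d}} (gcd[m,n]∣n s d)) (λ g≡d → d∤s (subst (_∣ s) g≡d (gcd[m,n]∣m s d)))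
    proper : ∀ {c} → c ∈ g ∷ properDivisors g → c ∈ properDivisors d
    proper (here refl) = ∈-properDivisors⁺ 0<g g<d (gcd[m,n]∣n s d)
    proper (there c∈)  =
      let 0<c , c<g , c∣g = ∈-properDivisors⁻ 0<g c∈
      in ∈-properDivisors⁺ 0<c (ℕ.<-trans c<g g<d) (ℕ.∣-trans c∣g (gcd[m,n]∣n s d))

  -- One of two distinct indices does not divide the other, and membership in the kernel of the
  -- other is a period.
  L∩L : ∀ {c d h} → 0 ℕ.< c → c ℕ.< N → 0 ℕ.< d → d ℕ.< N → c ≢ d → L c h → L d h → ∀ j → h j ≡ 0ℤ
  L∩L {c} {d} 0<c c<N 0<d d<N c≢d Lch Ldh with d ∣? c
  ... | no  d∤c = L∩Periodic 0<d d<N d∤c Ldh (L-periodic (cyc 0<c c<N) Lch)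
  ... | yes d∣c = L∩Periodic 0<c c<N (λ c∣d → c≢d (ℕ.∣-antisym c∣d d∣c)) Lch (L-periodic (cyc 0<d d<N) Ldh)

  -- Dropping either of the factors c, d shows that (Sⁿ - 1) h lies in L c ∩ L d.
  ker-divisors : ∀ n k ds → length ds ℕ.≤ k → Unique ds → All (λ d → 0 ℕ.< d × d ℕ.< N × d ∣ n) ds →
    ∀ {h} → (∀ j → actΦ ds h j ≡ 0ℤ) → Periodic n h
  ker-divisors n k [] le uniq divs eq j = trans (eq (n ℕ.+ j)) (sym (eq j))
  ker-divisors n k (d ∷ []) le uniq ((0<d , d<N , d∣n) ∷ []) eq = Periodic-∣ d∣n (L-periodic (cyc 0<d d<N) eq)
  ker-divisors n (suc k) (c ∷ d ∷ ds) (s≤s le) ((c≢d ∷ c∉ds) ∷ d∉ds ∷ uniq) (pc@(0<c , c<N , _) ∷ pd@(0<d , d<N , _) ∷ pds) {h} eq j =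
    ℤ.i-j≡0⇒i≡j _ _ (L∩L 0<c c<N 0<d d<N c≢d (difference c Φch) (difference d Φdh) j)
    where
    Φch : Periodic n (act (Φ c) h)
    Φch = ker-divisors n k (d ∷ ds) le (d∉ds ∷ uniq) (pd ∷ pds)
      (λ j → trans (sym (actΦ-comm (Φ c) (d ∷ ds) h j)) (eq j))
    Φdh : Periodic n (act (Φ d) h)
    Φdh = ker-divisors n k (c ∷ ds) le (c∉ds ∷ uniq) (pc ∷ pds)
      (λ j → trans (act-cong (Φ c) (λ i → sym (actΦ-comm (Φ d) ds h i)) j) (eq j))
    difference : ∀ c → Periodic n (act (Φ c) h) → L c (λ j → h (n ℕ.+ j) - h j)
    difference c per j = trans (act-- (Φ c) (λ j → h (n ℕ.+ j)) h j)
      (ℤ.i≡j⇒i-j≡0 (trans (act-shift (Φ c) h n j) (per j)))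

cyclotomics≡ : ∀ n → cyclotomics n ≡ map (λ d → d , Φ d) (range n)
cyclotomics≡ zero    = refl
cyclotomics≡ (suc n) = trans (cong (_∷ʳ (suc n , Φ (suc n))) (cyclotomics≡ n))
  (sym (trans (cong (map (λ d → d , Φ d)) (range-∷ʳ n)) (List.map-++ (λ d → d , Φ d) (range n) _)))

map-proj₂-filter : ∀ n ds →
  map proj₂ (filter (λ dΦ → proj₁ dΦ ∣? n) (map (λ d → d , Φ d) ds)) ≡ map Φ (filter (_∣? n) ds)
map-proj₂-filter n []       = refl
map-proj₂-filter n (d ∷ ds) with d ∣? n
... | yes _ = cong (Φ d ∷_) (map-proj₂-filter n ds)
... | no  _ = map-proj₂-filter n ds

Φ≡ : ∀ n → Φ n ≡ (X^ n +ₚ (-1ℤ ∷ [])) div Φproduct (properDivisors n)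
Φ≡ n = cong (λ ps → (X^ n +ₚ (-1ℤ ∷ [])) div foldr _*ₚ_ (1ℤ ∷ []) ps)
  (trans (cong (λ l → map proj₂ (filter (λ dΦ → proj₁ dΦ ∣? n) l)) (cyclotomics≡ (pred n))) (map-proj₂-filter n (range (pred n))))

Φproduct-monic : ∀ ds → (∀ {d} → d ∈ ds → Cyclotomic d) → Monic (Φproduct ds) (Σ (map (deg ∘ Φ) ds))
Φproduct-monic []       cyc = [] , refl , refl
Φproduct-monic (d ∷ ds) cyc = Monic-*ₚ (Φ-monic (cyc (here refl))) (Φproduct-monic ds (cyc ∘ there))

Cyclotomic-step : ∀ n → (∀ {d} → 0 ℕ.< d → d ℕ.< suc n → Cyclotomic d) → Cyclotomic (suc n)
Cyclotomic-step n cyc = record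
  { Φ-monic = subst₂ Monic (sym Φ≡l) (sym Φ-deg) mon
  ; degrees = trans (cong (ℕ._+ Σ (map (deg ∘ Φ) ds)) Φ-deg)
      (trans (cong (length l ∸ deg P ℕ.+_) (sym (Monic-deg P-monic))) (trans (ℕ.m∸n+n≡m deg≤) length-l))
  ; factor  = λ h j → begin
      h (suc n ℕ.+ j) - h j                       ≡⟨ act-Xⁿ-1 (suc n) h j ⟨
      act (X^ (suc n) +ₚ (-1ℤ ∷ [])) h j          ≡⟨ cong (λ F → act F h j) F≡ ⟩
      act (l ∷ʳ 1ℤ) h j                           ≡⟨ div-exact P-monic (l ∷ʳ 1ℤ) ker⊆ker h j ⟩
      act ((l ∷ʳ 1ℤ) div P) (act P h) j           ≡⟨ cong (λ F → act F (act P h) j) Φ≡l ⟨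
      act (Φ (suc n)) (act P h) j                 ≡⟨ act-cong (Φ (suc n)) (act-Φproduct ds h) j ⟩
      act (Φ (suc n)) (actΦ ds h) j               ∎
  }
  where
  open ≡-Reasoning
  ds = properDivisors (suc n)
  P = Φproduct ds
  l = -1ℤ ∷ replicate n 0ℤ
  length-l : length l ≡ suc n
  length-l = cong suc (List.length-replicate n)
  F≡ : X^ (suc n) +ₚ (-1ℤ ∷ []) ≡ l ∷ʳ 1ℤ
  F≡ = cong (-1ℤ ∷_) (+ₚ-identityʳ (X^ n))
  Φ≡l : Φ (suc n) ≡ (l ∷ʳ 1ℤ) div P
  Φ≡l = trans (Φ≡ (suc n)) (cong (_div P) F≡)
  proper : ∀ {d} → d ∈ ds → 0 ℕ.< d × d ℕ.< suc n × d ∣ suc n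
  proper = ∈-properDivisors⁻ (s≤s z≤n)
  P-monic : Monic P (Σ (map (deg ∘ Φ) ds))
  P-monic = Φproduct-monic ds (λ d∈ → let 0<d , d<n , _ = proper d∈ in cyc 0<d d<n)
  -- Exactness in terms of kernels: what the product over the proper divisors kills has period
  -- `suc n`, so `X^ (suc n) - 1` kills it too.
  ker⊆ker : ∀ {h} → Ker P h → Ker (l ∷ʳ 1ℤ) h
  ker⊆ker {h} ker = subst (λ F → Ker F h) F≡ (Periodic⇒Ker (suc n)
    (Below.ker-divisors (suc n) cyc (suc n) (length ds) ds ℕ.≤-refl
      (Unique.filter⁺ (_∣? suc n) (range-Unique n)) (All.tabulate proper)
      (λ j → trans (sym (act-Φproduct ds h j)) (ker j))))
  mon : Monic ((l ∷ʳ 1ℤ) div P) (length l ∸ deg P)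
  mon = proj₁ (div-monic P-monic l ker⊆ker)
  deg≤ : deg P ℕ.≤ length l
  deg≤ = proj₂ (div-monic P-monic l ker⊆ker)
  Φ-deg : deg (Φ (suc n)) ≡ length l ∸ deg P
  Φ-deg = trans (cong deg Φ≡l) (Monic-deg mon)

cyclotomic : ∀ {n} → 0 ℕ.< n → Cyclotomic n
cyclotomic {n} = <-rec (λ n → 0 ℕ.< n → Cyclotomic n)
  (λ { (suc n) rec _ → Cyclotomic-step n (λ 0<d d<n → rec d<n 0<d) }) n

L⇒Periodic : ∀ {d h} → 0 ℕ.< d → L d h → Periodic d h
L⇒Periodic 0<d = L-periodic (cyclotomic 0<d)

L∩Periodic : ∀ {d s h} → 0 ℕ.< d → ¬ d ∣ s → L d h → Periodic s h → ∀ j → h j ≡ 0ℤ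
L∩Periodic {d} 0<d = Below.L∩Periodic (suc d) (λ 0<c _ → cyclotomic 0<c) 0<d ℕ.≤-refl

L∩L : ∀ {c d h} → 0 ℕ.< c → 0 ℕ.< d → c ≢ d → L c h → L d h → ∀ j → h j ≡ 0ℤ
L∩L {c} {d} 0<c 0<d = Below.L∩L (suc (c ℕ.+ d)) (λ 0<c _ → cyclotomic 0<c) 0<c (s≤s (ℕ.m≤m+n c d)) 0<d (s≤s (ℕ.m≤n+m d c))

-- Characterisation of L d by vanishing sums along arithmetic progressions

-- The operator `1 + Sˢ + … + S^((k-1)s)`. Unlike `Φ d`, it is explicit enough to be followed
-- through products and subsequences.
progressionSum : ℕ → ℕ → Seq → Seq
progressionSum s zero    h j = 0ℤ
progressionSum s (suc k) h j = h j + progressionSum s k h (s ℕ.+ j)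

act-progressionSum : ∀ f s k h j → act f (progressionSum s k h) j ≡ progressionSum s k (act f h) j
act-progressionSum f s zero    h j = act-0 f (λ _ → refl) j
act-progressionSum f s (suc k) h j = trans (act-+ f h _ j)
  (cong (λ x → act f h j + x) (trans (act-shift f (progressionSum s k h) s j) (act-progressionSum f s k h (s ℕ.+ j))))

progressionSum-0 : ∀ s k {h} → (∀ j → h j ≡ 0ℤ) → ∀ j → progressionSum s k h j ≡ 0ℤ
progressionSum-0 s zero    eq j = refl
progressionSum-0 s (suc k) eq j = cong₂ _+_ (eq j) (progressionSum-0 s k eq (s ℕ.+ j))

progressionSum-cong : ∀ s k {h h′} → h ≗ h′ → progressionSum s k h ≗ progressionSum s k h′
progressionSum-cong s zero    eq j = refl
progressionSum-cong s (suc k) eq j = cong₂ _+_ (eq j) (progressionSum-cong s k eq (s ℕ.+ j))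

progressionSum-telescope : ∀ s k h j →
  h j + progressionSum s k h (s ℕ.+ j) ≡ progressionSum s k h j + h (k ℕ.* s ℕ.+ j)
progressionSum-telescope s zero    h j = ℤ.+-comm (h j) 0ℤ
progressionSum-telescope s (suc k) h j = trans
  (cong (h j +_) (progressionSum-telescope s k h (s ℕ.+ j)))
  (trans (sym (ℤ.+-assoc (h j) _ _)) (cong (λ i → h j + progressionSum s k h (s ℕ.+ j) + h i)
    (trans (sym (ℕ.+-assoc (k ℕ.* s) s j)) (cong (ℕ._+ j) (ℕ.+-comm (k ℕ.* s) s)))))

progressionSum-periodic : ∀ s k {h} → Periodic s h → ∀ j → progressionSum s k h j ≡ ℤ.+ k * h j
progressionSum-periodic s zero    per j = refl
progressionSum-periodic s (suc k) {h} per j =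
  trans (cong (h j +_) (trans (progressionSum-periodic s k per (s ℕ.+ j)) (cong (ℤ.+ k *_) (per j))))
        (sym (ℤ.suc-* (ℤ.+ k) (h j)))

-- The sums stay in `L d`, and they telescope to an `s`-periodic sequence because `h` returns to
-- itself after `k s` steps. `L∩Periodic` leaves only 0.
L⇒progressionSum : ∀ {d h} s k → 0 ℕ.< d → ¬ d ∣ s → d ∣ k ℕ.* s → L d h → ∀ j → progressionSum s k h j ≡ 0ℤ
L⇒progressionSum {d} {h} s k 0<d d∤s d∣ks Ldh = L∩Periodic 0<d d∤s
  (λ j → trans (act-progressionSum (Φ d) s k h j) (progressionSum-0 s k Ldh j))
  (λ j → Algebra.Properties.AbelianGroup.∙-cancelˡ ℤ.+-0-abelianGroup (h j) _ _ (trans (progressionSum-telescope s k h j)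
    (trans (cong (λ x → progressionSum s k h j + x) (Periodic-∣ d∣ks (L⇒Periodic 0<d Ldh) j)) (ℤ.+-comm _ (h j)))))

-- The claim is that `u = Φ d (S) h` vanishes. It inherits the vanishing sums, and the product over
-- the proper divisors kills it. Each factor is injective there: a sequence in `L c` has period `s`,
-- so its sum is `k` times a term.
progressionSum⇒L : ∀ {d h} → 0 ℕ.< d → Periodic d h →
  (∀ {c} → 0 ℕ.< c → c ℕ.< d → c ∣ d →
     ∃[ s ] ∃[ k ] c ∣ s × 0 ℕ.< k × (∀ j → progressionSum s k h j ≡ 0ℤ)) →
  L d h
progressionSum⇒L {d} {h} 0<d per sums =
  actΦ-injective W stable {properDivisors d} injective {act (Φ d) h} (λ c∈ → stable (Φ d) {h} (λ c∈ → hyp c∈) c∈)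
    (λ j → trans (sym (actΦ-comm (Φ d) (properDivisors d) h j)) (factor-periodic (cyclotomic 0<d) per j))
  where
  step : ∀ {c} → c ∈ properDivisors d →
    ∃[ s ] ∃[ k ] c ∣ s × 0 ℕ.< k × (∀ j → progressionSum s k h j ≡ 0ℤ)
  step c∈ = let 0<c , c<d , c∣d = ∈-properDivisors⁻ 0<d c∈ in sums 0<c c<d c∣d
  W : Seq → Set
  W u = ∀ {c} (c∈ : c ∈ properDivisors d) → let s , k , _ = step c∈ in ∀ j → progressionSum s k u j ≡ 0ℤ
  hyp : W h
  hyp c∈ = let _ , _ , _ , _ , eq = step c∈ in eq
  stable : ∀ f {u} → W u → W (act f u)
  stable f {u} Wu c∈ j = let s , k , _ = step c∈ in
    trans (sym (act-progressionSum f s k u j)) (act-0 f (Wu c∈) j)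
  injective : ∀ {c u} → c ∈ properDivisors d → W u → L c u → ∀ j → u j ≡ 0ℤ
  injective {c} {u} c∈ Wu Lcu j with step c∈ | Wu c∈ j
  ... | s , suc k , c∣s , _ , _ | eq =
    [ (λ ()) , id ]′ (ℤ.i*j≡0⇒i≡0∨j≡0 (ℤ.+ suc k)
      (trans (sym (progressionSum-periodic s (suc k) (Periodic-∣ c∣s (L⇒Periodic (proj₁ (∈-properDivisors⁻ 0<d c∈)) Lcu)) j)) eq))

-- The degree of Φ

Unique-length : ∀ {xs ys : List ℕ} → Unique xs → Unique ys →
  (∀ {x} → x ∈ xs → x ∈ ys) → (∀ {x} → x ∈ ys → x ∈ xs) → length xs ≡ length ys
Unique-length xs! ys! xs⊆ys ys⊆xs = ↭-length (∼bag⇒↭ (unique∧set⇒bag xs! ys! (mk⇔ xs⊆ys ys⊆xs)))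

coprimes : ℕ → List ℕ
coprimes d = filter (λ i → coprime? i d) (range d)

-- The condition is `gcd k n = n / d` without the division: for `n > 0`, the elements of order `d`
-- in the cyclic group of order `n`.
gcdFibre : ℕ → ℕ → List ℕ
gcdFibre n d = filter (λ k → d ℕ.* gcd k n ℕ.≟ n) (range n)

gcdFibre-Unique : ∀ n d → Unique (gcdFibre n d)
gcdFibre-Unique n d = Unique.filter⁺ (λ k → d ℕ.* gcd k n ℕ.≟ n) (range-Unique n)

-- Multiplication by `q = n / d` is a bijection from the residues coprime to `d`, as
-- `gcd (q i) (q d) = q · gcd i d`.
length-gcdFibre : ∀ {n d} → 0 ℕ.< n → d ∣ n → length (gcdFibre n d) ≡ φ d
length-gcdFibre {n} {d} 0<n (divides q refl) =
  trans (Unique-length (gcdFibre-Unique n d) (Unique.map⁺ (ℕ.*-cancelˡ-≡ _ _ q) (Unique.filter⁺ (λ i → coprime? i d) (range-Unique d))) to from)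
        (List.length-map (q ℕ.*_) (coprimes d))
  where
  instance
    qd≢0 : ℕ.NonZero (q ℕ.* d)
    qd≢0 = ℕ.>-nonZero 0<n
    q≢0 : ℕ.NonZero q
    q≢0 = ℕ.m*n≢0⇒m≢0 q
    d≢0 : ℕ.NonZero d
    d≢0 = ℕ.m*n≢0⇒n≢0 q
  to : ∀ {k} → k ∈ gcdFibre n d → k ∈ map (q ℕ.*_) (coprimes d)
  to {k} k∈ with ∈-filter⁻ (λ k → d ℕ.* gcd k n ℕ.≟ n) {xs = range n} k∈
  ... | k∈range , eq with subst (_∣ k) g≡q (gcd[m,n]∣m k n)
    where
    g≡q : gcd k n ≡ q
    g≡q = ℕ.*-cancelˡ-≡ _ _ d (trans eq (ℕ.*-comm q d))
  ... | divides i refl = subst (_∈ map (q ℕ.*_) (coprimes d)) (ℕ.*-comm q i)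
    (∈-map⁺ (q ℕ.*_) (∈-filter⁺ (λ i → coprime? i d)
      (∈-range⁺ (ℕ.n≢0⇒n>0 (λ { refl → ℕ.m<n⇒n≢0 (proj₁ (∈-range⁻ k∈range)) refl }))
                (ℕ.*-cancelˡ-≤ q (ℕ.≤-trans (ℕ.≤-reflexive (ℕ.*-comm q i)) (proj₂ (∈-range⁻ k∈range)))))
      (gcd≡1⇒coprime (ℕ.*-cancelˡ-≡ _ _ q (begin
        q ℕ.* gcd i d            ≡⟨ c*gcd[m,n]≡gcd[cm,cn] q i d ⟩
        gcd (q ℕ.* i) (q ℕ.* d)  ≡⟨ cong (λ k → gcd k n) (ℕ.*-comm q i) ⟩
        gcd (i ℕ.* q) (q ℕ.* d)  ≡⟨ ℕ.*-cancelˡ-≡ _ _ d (trans eq (ℕ.*-comm q d)) ⟩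
        q                        ≡⟨ ℕ.*-identityʳ q ⟨
        q ℕ.* 1                  ∎)))))
    where open ≡-Reasoning
  from : ∀ {k} → k ∈ map (q ℕ.*_) (coprimes d) → k ∈ gcdFibre n d
  from k∈ with ∈-map⁻ (q ℕ.*_) k∈
  ... | i , i∈ , refl with ∈-filter⁻ (λ i → coprime? i d) {xs = range d} i∈
  ... | i∈range , coprime with ∈-range⁻ i∈range
  ... | 0<i , i≤d = ∈-filter⁺ (λ k → d ℕ.* gcd k n ℕ.≟ n)
    (∈-range⁺ (ℕ.>-nonZero⁻¹ (q ℕ.* i) {{ℕ.m*n≢0 q i {{q≢0}} {{ℕ.>-nonZero 0<i}}}}) (ℕ.*-monoʳ-≤ q i≤d))
    (begin
      d ℕ.* gcd (q ℕ.* i) (q ℕ.* d)  ≡⟨ cong (d ℕ.*_) (c*gcd[m,n]≡gcd[cm,cn] q i d) ⟨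
      d ℕ.* (q ℕ.* gcd i d)          ≡⟨ cong (λ g → d ℕ.* (q ℕ.* g)) (coprime⇒gcd≡1 coprime) ⟩
      d ℕ.* (q ℕ.* 1)                ≡⟨ cong (d ℕ.*_) (ℕ.*-identityʳ q) ⟩
      d ℕ.* q                        ≡⟨ ℕ.*-comm d q ⟩
      q ℕ.* d                        ∎)
    where open ≡-Reasoning

∈-divisors⁺ : ∀ {n d} → 0 ℕ.< n → d ∣ n → d ∈ divisors n
∈-divisors⁺ {n} {d} 0<n d∣n = ∈-filter⁺ (_∣? n)
  (∈-range⁺ (ℕ.n≢0⇒n>0 (λ { refl → ℕ.m<n⇒n≢0 0<n (ℕ.0∣⇒≡0 d∣n) })) (ℕ.∣⇒≤ {{ℕ.>-nonZero 0<n}} d∣n)) d∣n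

∈-divisors⁻ : ∀ {n d} → d ∈ divisors n → 0 ℕ.< d × d ∣ n
∈-divisors⁻ {n} d∈ with ∈-filter⁻ (_∣? n) {xs = range n} d∈
... | d∈range , d∣n = proj₁ (∈-range⁻ d∈range) , d∣n

divisors-Unique : ∀ n → Unique (divisors n)
divisors-Unique n = Unique.filter⁺ (_∣? n) (range-Unique n)

length-concatMap : ∀ {A : Set} (f : ℕ → List A) ds → length (List.concatMap f ds) ≡ Σ (map (length ∘ f) ds)
length-concatMap f []       = refl
length-concatMap f (d ∷ ds) = trans (List.length-++ (f d)) (cong (length (f d) ℕ.+_) (length-concatMap f ds))

map-cong-∈ : ∀ {f g : ℕ → ℕ} ds → (∀ {d} → d ∈ ds → f d ≡ g d) → map f ds ≡ map g ds
map-cong-∈ []       eq = refl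
map-cong-∈ (d ∷ ds) eq = cong₂ _∷_ (eq (here refl)) (map-cong-∈ ds (eq ∘ there))

Σφ : ∀ {n} → 0 ℕ.< n → Σ (map φ (divisors n)) ≡ n
Σφ {n} 0<n = begin
  Σ (map φ (divisors n))                        ≡⟨ cong Σ (map-cong-∈ (divisors n) (λ d∈ → length-gcdFibre 0<n (proj₂ (∈-divisors⁻ {n} d∈)))) ⟨
  Σ (map (length ∘ gcdFibre n) (divisors n))    ≡⟨ length-concatMap (gcdFibre n) (divisors n) ⟨
  length (List.concatMap (gcdFibre n) (divisors n))
    ≡⟨ Unique-length
         (Unique.concat⁺ (All.map⁺ (All.universal (gcdFibre-Unique n) (divisors n)))
                         (AllPairs.map⁺ (AllPairs.map disjoint (divisors-Unique n))))
         (range-Unique n) to from ⟩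
  length (range n)                              ≡⟨ trans (List.length-map suc (upTo n)) (List.length-upTo n) ⟩
  n                                             ∎
  where
  open ≡-Reasoning
  fibre⁻ : ∀ {d k} → k ∈ gcdFibre n d → k ∈ range n × d ℕ.* gcd k n ≡ n
  fibre⁻ {d} = ∈-filter⁻ (λ k → d ℕ.* gcd k n ℕ.≟ n) {xs = range n}
  disjoint : ∀ {c d} → c ≢ d → ∀ {k} → ¬ (k ∈ gcdFibre n c × k ∈ gcdFibre n d)
  disjoint {c} {d} c≢d {k} (k∈c , k∈d) = c≢d (ℕ.*-cancelʳ-≡ c d (gcd k n)
    {{ℕ.m*n≢0⇒n≢0 c {{subst ℕ.NonZero (sym (proj₂ (fibre⁻ {c} k∈c))) (ℕ.>-nonZero 0<n)}}}}
    (trans (proj₂ (fibre⁻ {c} k∈c)) (sym (proj₂ (fibre⁻ {d} k∈d)))))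
  to : ∀ {k} → k ∈ List.concatMap (gcdFibre n) (divisors n) → k ∈ range n
  to k∈ with Any.satisfied (∈-concatMap⁻ (gcdFibre n) {xs = divisors n} k∈)
  ... | d , k∈d = proj₁ (fibre⁻ {d} k∈d)
  from : ∀ {k} → k ∈ range n → k ∈ List.concatMap (gcdFibre n) (divisors n)
  from {k} k∈ with gcd[m,n]∣n k n
  ... | divides d eq = ∈-concatMap⁺ (gcdFibre n) (Any.map (λ { refl → ∈-filter⁺ (λ k → d ℕ.* gcd k n ℕ.≟ n) k∈ (sym eq) })
      (∈-divisors⁺ 0<n (divides (gcd k n) (trans eq (ℕ.*-comm d (gcd k n))))))

divisors-∷ʳ : ∀ n → divisors (suc n) ≡ properDivisors (suc n) ∷ʳ suc n
divisors-∷ʳ n = trans (cong (filter (_∣? suc n)) (range-∷ʳ n))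
  (trans (List.filter-++ (_∣? suc n) (range n) (suc n ∷ []))
         (cong (properDivisors (suc n) ++_) (List.filter-accept (_∣? suc n) ℕ.∣-refl)))

-- Degrees of `Φ` and values of `φ` have the same sum `n` over the divisors of `n`; by induction the
-- terms of the proper divisors cancel.
deg-Φ : ∀ {n} → 0 ℕ.< n → deg (Φ n) ≡ φ n
deg-Φ {n} = <-rec (λ n → 0 ℕ.< n → deg (Φ n) ≡ φ n) step n
  where
  step : ∀ n → (∀ {d} → d ℕ.< n → 0 ℕ.< d → deg (Φ d) ≡ φ d) → 0 ℕ.< n → deg (Φ n) ≡ φ n
  step (suc n) rec 0<n = ℕ.+-cancelʳ-≡ (Σ (map φ ds)) _ _ (begin
    deg (Φ (suc n)) ℕ.+ Σ (map φ ds)            ≡⟨ cong (λ l → deg (Φ (suc n)) ℕ.+ Σ l) (map-cong-∈ ds (λ d∈ → let 0<d , d<n , _ = ∈-properDivisors⁻ 0<n d∈ in rec d<n 0<d)) ⟨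
    deg (Φ (suc n)) ℕ.+ Σ (map (deg ∘ Φ) ds)    ≡⟨ Cyclotomic.degrees (cyclotomic 0<n) ⟩
    suc n                                       ≡⟨ Σφ 0<n ⟨
    Σ (map φ (divisors (suc n)))                ≡⟨ cong (Σ ∘ map φ) (divisors-∷ʳ n) ⟩
    Σ (map φ (ds ∷ʳ suc n))                     ≡⟨ cong Σ (List.map-++ φ ds _) ⟩
    Σ (map φ ds ∷ʳ φ (suc n))                   ≡⟨ Σ.sum-++ (map φ ds) _ ⟩
    Σ (map φ ds) ℕ.+ (φ (suc n) ℕ.+ 0)          ≡⟨ cong (Σ (map φ ds) ℕ.+_) (ℕ.+-identityʳ _) ⟩
    Σ (map φ ds) ℕ.+ φ (suc n)                  ≡⟨ ℕ.+-comm (Σ (map φ ds)) _ ⟩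
    φ (suc n) ℕ.+ Σ (map φ ds)                  ∎)
    where
    open ≡-Reasoning
    ds = properDivisors (suc n)

-- The rows of A

Ker-sum : ∀ f {n} {H : Fin n → Seq} (c : Fin n → ℤ) → (∀ i → Ker f (H i)) → Ker f (λ j → sum (λ i → c i * H i j))
Ker-sum f {zero}      c ker j = act-0 f (λ _ → refl) j
Ker-sum f {suc n} {H} c ker j = trans (act-+ f (λ j → c zero * H zero j) _ j)
  (cong₂ _+_ (trans (act-* f (c zero) (H zero) j) (trans (cong (c zero *_) (ker zero j)) (ℤ.*-zeroʳ (c zero))))
             (Ker-sum f (c ∘ suc) (ker ∘ suc) j))

act-sum : ∀ {n} f x → length f ≡ n → act f x 0 ≡ sum {n} (λ i → x (toℕ i) * coeff f (toℕ i))
act-sum []      x refl = refl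
act-sum (a ∷ f) x refl = cong₂ _+_ (ℤ.*-comm a (x 0)) (trans (sym (act-shift f x 1 0)) (act-sum f (x ∘ suc) refl))

𝐞 : ℕ → ℕ → Seq
𝐞 d = basis (Φ d)

𝐞∈L : ∀ {d} i → 0 ℕ.< d → L d (𝐞 d i)
𝐞∈L i 0<d = basis-Ker (Cyclotomic.Φ-monic (cyclotomic 0<d)) i

coeff-mod-Φ : ∀ {d i} j → 0 ℕ.< d → i ℕ.< φ d → coeff (X^ j mod Φ d) i ≡ 𝐞 d i j
coeff-mod-Φ {d} {i} j 0<d lt = trans
  (coeff-mod (Cyclotomic.Φ-monic (cyclotomic 0<d)) (X^ j) (ℕ.≤-trans lt (ℕ.≤-reflexive (sym (deg-Φ 0<d)))))
  (trans (act-X^ j (𝐞 d i) 0) (cong (𝐞 d i) (ℕ.+-identityʳ j)))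

-- `h j` is the value at 0 of `Xʲ` acting on `h`, and on `L d` the power may be replaced by its
-- remainder modulo `Φ d`. The weights are therefore the initial terms of `h`.
L-expansion : ∀ {d h} → 0 ℕ.< d → L d h → ∀ j → h j ≡ sum {φ d} (λ i → h (toℕ i) * 𝐞 d (toℕ i) j)
L-expansion {d} {h} 0<d Ldh j = begin
  h j                          ≡⟨ cong h (ℕ.+-identityʳ j) ⟨
  h (j ℕ.+ 0)                  ≡⟨ act-X^ j h 0 ⟨
  act (X^ j) h 0               ≡⟨ act-mod (Cyclotomic.Φ-monic (cyclotomic 0<d)) (X^ j) Ldh ⟩
  act (X^ j mod Φ d) h 0       ≡⟨ act-sum (X^ j mod Φ d) h (trans (length-mod (X^ j) (Φ d)) (deg-Φ 0<d)) ⟩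
  sum {φ d} (λ i → h (toℕ i) * coeff (X^ j mod Φ d) (toℕ i))
    ≡⟨ sum-cong-≗ {φ d} (λ i → cong (h (toℕ i) *_) (coeff-mod-Φ j 0<d (Fin.toℕ<n i))) ⟩
  sum {φ d} (λ i → h (toℕ i) * 𝐞 d (toℕ i) j) ∎
  where open ≡-Reasoning

block : ℕ → Poly → List ℤ
block d f = toList (coords d f)

length-block : ∀ d f → length (block d f) ≡ φ d
length-block d f = Vec.length-toList (coords d f)

coeff-block : ∀ {d i} j → 0 ℕ.< d → i ℕ.< φ d → coeff (block d (X^ j)) i ≡ 𝐞 d i j
coeff-block {d} j 0<d lt = trans (coeff-coeffs (coeff (X^ j mod Φ d)) lt) (coeff-mod-Φ j 0<d lt)

blocks : List ℕ → Poly → List ℤ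
blocks ds f = List.concatMap (λ d → block d f) ds

length-blocks : ∀ ds f → length (blocks ds f) ≡ Σ (map φ ds)
length-blocks ds f = trans (length-concatMap (λ d → block d f) ds) (cong Σ (map-cong-∈ ds (λ {d} _ → length-block d f)))

coeff-++ʳ : ∀ f g i → coeff (f ++ g) (length f ℕ.+ i) ≡ coeff g i
coeff-++ʳ []      g i = refl
coeff-++ʳ (a ∷ f) g i = coeff-++ʳ f g i

coeff-blocks-head : ∀ d ds {i} j → 0 ℕ.< d → i ℕ.< φ d → coeff (blocks (d ∷ ds) (X^ j)) i ≡ 𝐞 d i j
coeff-blocks-head d ds j 0<d lt =
  trans (coeff-++ˡ (block d (X^ j)) (ℕ.≤-trans lt (ℕ.≤-reflexive (sym (length-block d (X^ j)))))) (coeff-block j 0<d lt)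

coeff-blocks-tail : ∀ d ds i f → coeff (blocks (d ∷ ds) f) (φ d ℕ.+ i) ≡ coeff (blocks ds f) i
coeff-blocks-tail d ds i f = trans (cong (λ l → coeff (blocks (d ∷ ds) f) (l ℕ.+ i)) (sym (length-block d f)))
  (coeff-++ʳ (block d f) (blocks ds f) i)

blocks-row⁻ : ∀ ds r → (∀ {d} → d ∈ ds → 0 ℕ.< d) → r ℕ.< Σ (map φ ds) →
  ∃[ d ] d ∈ ds × ∃[ i ] (∀ j → coeff (blocks ds (X^ j)) r ≡ 𝐞 d i j)
blocks-row⁻ (d ∷ ds) r pos lt with ℕ.<-≤-connex r (φ d)
... | inj₁ r<φ = d , here refl , r , λ j → coeff-blocks-head d ds j (pos (here refl)) r<φ
... | inj₂ φ≤r with ℕ.m≤n⇒∃[o]m+o≡n φ≤r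
... | r′ , refl with blocks-row⁻ ds r′ (pos ∘ there) (ℕ.+-cancelˡ-< (φ d) _ _ lt)
... | c , c∈ , i , eq = c , there c∈ , i , λ j → trans (coeff-blocks-tail d ds r′ (X^ j)) (eq j)

blocks-row⁺ : ∀ {d ds i} → (∀ {d} → d ∈ ds → 0 ℕ.< d) → d ∈ ds → i ℕ.< φ d →
  ∃[ r ] r ℕ.< Σ (map φ ds) × (∀ j → coeff (blocks ds (X^ j)) r ≡ 𝐞 d i j)
blocks-row⁺ {d} {_ ∷ ds} {i} pos (here refl) lt =
  i , ℕ.≤-trans lt (ℕ.m≤m+n (φ d) _) , λ j → coeff-blocks-head d ds j (pos (here refl)) lt
blocks-row⁺ {d} {c ∷ ds} pos (there d∈) lt with blocks-row⁺ (pos ∘ there) d∈ lt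
... | r , r< , eq = φ c ℕ.+ r , ℕ.+-monoʳ-< (φ c) r< , λ j → trans (coeff-blocks-tail c ds r (X^ j)) (eq j)

actΦ-+ : ∀ ds h h′ j → actΦ ds (λ i → h i + h′ i) j ≡ actΦ ds h j + actΦ ds h′ j
actΦ-+ []       h h′ j = refl
actΦ-+ (d ∷ ds) h h′ j = trans (act-cong (Φ d) (actΦ-+ ds h h′) j) (act-+ (Φ d) (actΦ ds h) (actΦ ds h′) j)

actΦ-cong : ∀ ds {h h′} → h ≗ h′ → actΦ ds h ≗ actΦ ds h′
actΦ-cong []       eq = eq
actΦ-cong (d ∷ ds) eq = act-cong (Φ d) (actΦ-cong ds eq)

-- Roles are exchanged here: the column is read as a polynomial acting on the sequence of weights,
-- and its value at 0 is the scalar product of the two.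
block-combination : ∀ d x j → 0 ℕ.< d →
  act (block d (X^ j)) x 0 ≡ sum {φ d} (λ i → x (toℕ i) * 𝐞 d (toℕ i) j)
block-combination d x j 0<d = trans (act-sum (block d (X^ j)) x (length-block d (X^ j)))
  (sum-cong-≗ {φ d} (λ i → cong (x (toℕ i) *_) (coeff-block j 0<d (Fin.toℕ<n i))))

block-combination∈L : ∀ d x → 0 ℕ.< d → L d (λ j → act (block d (X^ j)) x 0)
block-combination∈L d x 0<d j = trans (act-cong (Φ d) (λ j → block-combination d x j 0<d) j)
  (Ker-sum (Φ d) {φ d} (x ∘ toℕ) (λ i → 𝐞∈L (toℕ i) 0<d) j)

sum-δ : ∀ {n j} (x : Seq) → j ℕ.< n → sum {n} (λ i → x (toℕ i) * δ (toℕ i) j) ≡ x j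
sum-δ {suc n} {zero}  x lt = trans (cong₂ _+_ (ℤ.*-identityʳ (x 0)) (sum-zero n (λ i → ℤ.*-zeroʳ (x (suc (toℕ i)))))) (ℤ.+-identityʳ _)
sum-δ {suc n} {suc j} x (s≤s lt) = trans (cong₂ _+_ (ℤ.*-zeroʳ (x 0)) (sum-δ (x ∘ suc) lt)) (ℤ.+-identityˡ _)

block-combination-initial : ∀ d x j → 0 ℕ.< d → j ℕ.< φ d → act (block d (X^ j)) x 0 ≡ x j
block-combination-initial d x j 0<d lt = trans (block-combination d x j 0<d)
  (trans (sum-cong-≗ {φ d} (λ i → cong (x (toℕ i) *_) (basis-initial (Φ d) (toℕ i) (ℕ.≤-trans lt (ℕ.≤-reflexive (sym (deg-Φ 0<d)))))))
         (sum-δ x lt))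

blocks-∷ : ∀ d ds x j → act (blocks (d ∷ ds) (X^ j)) x 0 ≡ act (block d (X^ j)) x 0 + act (blocks ds (X^ j)) (λ i → x (φ d ℕ.+ i)) 0
blocks-∷ d ds x j = trans (act-++ (block d (X^ j)) (blocks ds (X^ j)) x 0)
  (cong (λ y → act (block d (X^ j)) x 0 + y) (trans (cong (λ l → act (blocks ds (X^ j)) x (l ℕ.+ 0)) (length-block d (X^ j)))
    (sym (act-shift (blocks ds (X^ j)) x (φ d) 0))))

blocks-killed : ∀ ds x → (∀ {d} → d ∈ ds → 0 ℕ.< d) → ∀ j → actΦ ds (λ j → act (blocks ds (X^ j)) x 0) j ≡ 0ℤ
blocks-killed []       x pos j = refl
blocks-killed (d ∷ ds) x pos j =
  trans (actΦ-cong (d ∷ ds) (blocks-∷ d ds x) j)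
  (trans (actΦ-+ (d ∷ ds) (λ j → act (block d (X^ j)) x 0) (λ j → act (blocks ds (X^ j)) (λ i → x (φ d ℕ.+ i)) 0) j)
    (cong₂ _+_ (actΦ-∈ {ds = d ∷ ds} (here refl) (block-combination∈L d x (pos (here refl))) j)
               (act-0 (Φ d) (blocks-killed ds (λ i → x (φ d ℕ.+ i)) (pos ∘ there)) j)))

-- In a vanishing combination the part `g` from `L d` is minus the rest, so the remaining `Φ c`
-- together kill it. They are injective on `L d`, hence `g` is 0, and its initial terms are the
-- weights of the block.
blocks-independent : ∀ ds x → (∀ {d} → d ∈ ds → 0 ℕ.< d) → Unique ds →
  (∀ j → act (blocks ds (X^ j)) x 0 ≡ 0ℤ) → ∀ {r} → r ℕ.< Σ (map φ ds) → x r ≡ 0ℤ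
blocks-independent (d ∷ ds) x pos (d∉ds ∷ ds!) eq {r} lt = conclude
  where
  g rest : Seq
  g j = act (block d (X^ j)) x 0
  rest j = act (blocks ds (X^ j)) (λ i → x (φ d ℕ.+ i)) 0
  0<d : 0 ℕ.< d
  0<d = pos (here refl)
  g+rest≡0 : ∀ j → g j + rest j ≡ 0ℤ
  g+rest≡0 j = trans (sym (blocks-∷ d ds x j)) (eq j)
  killed : ∀ j → actΦ ds g j ≡ 0ℤ
  killed j = begin
    actΦ ds g j                       ≡⟨ ℤ.+-identityʳ _ ⟨
    actΦ ds g j + 0ℤ                  ≡⟨ cong (λ y → actΦ ds g j + y) (blocks-killed ds (λ i → x (φ d ℕ.+ i)) (pos ∘ there) j) ⟨
    actΦ ds g j + actΦ ds rest j      ≡⟨ actΦ-+ ds g rest j ⟨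
    actΦ ds (λ i → g i + rest i) j    ≡⟨ actΦ-0 ds g+rest≡0 j ⟩
    0ℤ                                ∎
    where open ≡-Reasoning
  g≡0 : ∀ j → g j ≡ 0ℤ
  g≡0 = actΦ-injective (L d) (L-stable d) {ds}
    (λ c∈ Ldh Lch → L∩L 0<d (pos (there c∈)) (All.lookup d∉ds c∈) Ldh Lch)
    (block-combination∈L d x 0<d) killed
  rest≡0 : ∀ j → rest j ≡ 0ℤ
  rest≡0 j = trans (sym (ℤ.+-identityˡ (rest j))) (trans (cong (_+ rest j) (sym (g≡0 j))) (g+rest≡0 j))
  conclude : x r ≡ 0ℤ
  conclude with ℕ.<-≤-connex r (φ d)
  ... | inj₁ r<φ = trans (sym (block-combination-initial d x r 0<d r<φ)) (g≡0 r)
  ... | inj₂ φ≤r with ℕ.m≤n⇒∃[o]m+o≡n φ≤r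
  ... | r′ , refl = blocks-independent ds (λ i → x (φ d ℕ.+ i)) (pos ∘ there) ds! rest≡0 (ℕ.+-cancelˡ-< (φ d) _ _ lt)

Periodic-% : ∀ {k h} .{{_ : ℕ.NonZero k}} → Periodic k h → ∀ j → h (j % k) ≡ h j
Periodic-% {k} {h} per j = trans (sym (Periodic-* (j ℕ./ k) per (j % k)))
  (cong h (trans (ℕ.+-comm _ (j % k)) (sym (m≡m%n+[m/n]*n j k))))

extend : ∀ {n} → (Fin n → ℤ) → Seq
extend {zero}  x _       = 0ℤ
extend {suc n} x zero    = x zero
extend {suc n} x (suc r) = extend (x ∘ suc) r

extend-toℕ : ∀ {n} (x : Fin n → ℤ) i → extend x (toℕ i) ≡ x i
extend-toℕ x zero    = refl
extend-toℕ x (suc i) = extend-toℕ (x ∘ suc) i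

-- Row `r` of `A k` continued to all exponents, so that the shift acts on it; by periodicity its
-- first `k` terms determine it.
row : (k : ℕ) → Fin k → Seq
row k r j = coeff (Ψ k (X^ j)) (toℕ r)

module _ {k : ℕ} (0<k : 0 ℕ.< k) where

  private
    pos : ∀ {d} → d ∈ divisors k → 0 ℕ.< d
    pos d∈ = proj₁ (∈-divisors⁻ {k} d∈)

  row∈L : ∀ r → ∃[ d ] 0 ℕ.< d × d ∣ k × L d (row k r)
  row∈L r with blocks-row⁻ (divisors k) (toℕ r) pos (ℕ.≤-trans (Fin.toℕ<n r) (ℕ.≤-reflexive (sym (Σφ 0<k))))
  ... | d , d∈ , i , eq with ∈-divisors⁻ {k} d∈
  ... | 0<d , d∣k = d , 0<d , d∣k , λ j → trans (act-cong (Φ d) eq j) (𝐞∈L i 0<d j)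

  𝐞-row : ∀ {d i} → d ∣ k → i ℕ.< φ d → ∃[ r ] row k r ≗ 𝐞 d i
  𝐞-row {d} {i} d∣k lt with blocks-row⁺ pos (∈-divisors⁺ 0<k d∣k) lt
  ... | r , r< , eq = fromℕ< (r<k) , λ j → trans (cong (coeff (Ψ k (X^ j))) (Fin.toℕ-fromℕ< r<k)) (eq j)
    where
    r<k : r ℕ.< k
    r<k = ℕ.≤-trans r< (ℕ.≤-reflexive (Σφ 0<k))

  row-periodic : ∀ r → Periodic k (row k r)
  row-periodic r = let d , 0<d , d∣k , Ldr = row∈L r in Periodic-∣ {h = row k r} d∣k (L⇒Periodic {h = row k r} 0<d Ldr)

  A-independent : ∀ (x : Fin k → ℤ) → (∀ j → sum (λ r → x r * A k r j) ≡ 0ℤ) → ∀ r → x r ≡ 0ℤ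
  A-independent x eq r = trans (sym (extend-toℕ x r))
    (blocks-independent (divisors k) (extend x) pos (divisors-Unique k) vanishes
      (ℕ.≤-trans (Fin.toℕ<n r) (ℕ.≤-reflexive (sym (Σφ 0<k)))))
    where
    instance
      k≢0 : ℕ.NonZero k
      k≢0 = ℕ.>-nonZero 0<k
    vanishes : ∀ j → act (Ψ k (X^ j)) (extend x) 0 ≡ 0ℤ
    vanishes j = begin
      act (Ψ k (X^ j)) (extend x) 0
        ≡⟨ act-sum (Ψ k (X^ j)) (extend x) (trans (length-blocks (divisors k) (X^ j)) (Σφ 0<k)) ⟩
      sum {k} (λ r → extend x (toℕ r) * row k r j)
        ≡⟨ sum-cong-≗ {k} (λ r → cong₂ _*_ (extend-toℕ x r) (trans (sym (Periodic-% {h = row k r} (row-periodic r) j))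
             (cong (row k r) (sym (Fin.toℕ-fromℕ< (m%n<n j k)))))) ⟩
      sum {k} (λ r → x r * A k r (fromℕ< (m%n<n j k)))
        ≡⟨ eq (fromℕ< (m%n<n j k)) ⟩
      0ℤ ∎
      where open ≡-Reasoning

-- L (d * d′) as a tensor product

-- The Chinese remainder idempotents: `a` is 1 modulo `d` and 0 modulo `d′`, and `b` the reverse.
-- Over the natural numbers the multiple `q` of `d d′` has to be recorded.
record Idempotents (d d′ : ℕ) : Set where
  field
    a b q    : ℕ
    d′∣a     : d′ ∣ a
    d∣b      : d ∣ b
    a+b≡1    : a ℕ.+ b ≡ 1 ℕ.+ q ℕ.* (d ℕ.* d′)

  -- Adding the multiple `c b` of `d` turns `c a` into `c (a + b)`, which is congruent to `c`.
  absorb : ∀ {f} → Periodic d f → ∀ c j → f (c ℕ.* a ℕ.+ j) ≡ f (c ℕ.+ j)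
  absorb {f} per c j = begin
    f (c ℕ.* a ℕ.+ j)                              ≡⟨ Periodic-∣ (ℕ.∣n⇒∣m*n c d∣b) per (c ℕ.* a ℕ.+ j) ⟨
    f (c ℕ.* b ℕ.+ (c ℕ.* a ℕ.+ j))                ≡⟨ cong f (regroup a b c j) ⟩
    f (c ℕ.* (a ℕ.+ b) ℕ.+ j)                      ≡⟨ cong (λ x → f (c ℕ.* x ℕ.+ j)) a+b≡1 ⟩
    f (c ℕ.* (1 ℕ.+ q ℕ.* (d ℕ.* d′)) ℕ.+ j)       ≡⟨ cong f (regroup′ c q d d′ j) ⟩
    f (c ℕ.* q ℕ.* d′ ℕ.* d ℕ.+ (c ℕ.+ j))         ≡⟨ Periodic-* (c ℕ.* q ℕ.* d′) per (c ℕ.+ j) ⟩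
    f (c ℕ.+ j)                                    ∎
    where
    open ≡-Reasoning
    regroup : ∀ a b c j → c ℕ.* b ℕ.+ (c ℕ.* a ℕ.+ j) ≡ c ℕ.* (a ℕ.+ b) ℕ.+ j
    regroup = ℕ-solve-∀
    regroup′ : ∀ c q d d′ j → c ℕ.* (1 ℕ.+ q ℕ.* (d ℕ.* d′)) ℕ.+ j ≡ c ℕ.* q ℕ.* d′ ℕ.* d ℕ.+ (c ℕ.+ j)
    regroup′ = ℕ-solve-∀

open Idempotents

idempotents : ∀ {d d′} → 0 ℕ.< d → 0 ℕ.< d′ → Coprime d d′ → Idempotents d d′
idempotents {suc d} {suc d′} _ _ coprime with coprime-Bézout coprime
... | Bézout.+- x y eq = record
  -- The natural choice for `a` would be minus `y` times the second modulus. Adding `y` times the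
  -- product of both moduli makes it non-negative; the variable `d` is the first modulus less one.
  { a = d ℕ.* y ℕ.* suc d′ ; b = x ℕ.* suc d ; q = y ; d′∣a = ℕ.n∣m*n (d ℕ.* y) ; d∣b = ℕ.n∣m*n x
  ; a+b≡1 = trans (cong (d ℕ.* y ℕ.* suc d′ ℕ.+_) (sym eq)) (lemma d d′ y) }
  where
  lemma : ∀ d d′ y → d ℕ.* y ℕ.* suc d′ ℕ.+ (1 ℕ.+ y ℕ.* suc d′) ≡ 1 ℕ.+ y ℕ.* (suc d ℕ.* suc d′)
  lemma = ℕ-solve-∀
... | Bézout.-+ x y eq = record
  { a = y ℕ.* suc d′ ; b = d′ ℕ.* x ℕ.* suc d ; q = x ; d′∣a = ℕ.n∣m*n y ; d∣b = ℕ.n∣m*n (d′ ℕ.* x)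
  ; a+b≡1 = trans (cong (ℕ._+ d′ ℕ.* x ℕ.* suc d) (sym eq)) (lemma d d′ x) }
  where
  lemma : ∀ d d′ x → 1 ℕ.+ x ℕ.* suc d ℕ.+ d′ ℕ.* x ℕ.* suc d ≡ 1 ℕ.+ x ℕ.* (suc d ℕ.* suc d′)
  lemma = ℕ-solve-∀

coprime-*∣ : ∀ {d d′ c} → Coprime d d′ → d ∣ c → d′ ∣ c → d ℕ.* d′ ∣ c
coprime-*∣ {d} {d′} coprime (divides t refl) d′∣td =
  subst (d ℕ.* d′ ∣_) (ℕ.*-comm d t) (ℕ.*-monoʳ-∣ d (coprime-divisor (Coprimality.sym coprime) (subst (d′ ∣_) (ℕ.*-comm t d) d′∣td)))

-- A step of `c a` is a multiple of `d′`, so `g` stays constant, while `f` sees it as a step of `c`.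
progressionSum-* : ∀ {d d′} (I : Idempotents d d′) {f g} → Periodic d f → Periodic d′ g → ∀ c k j →
  progressionSum (c ℕ.* a I) k (λ i → f i * g i) j ≡ g j * progressionSum c k f j
progressionSum-* I {f} {g} perf perg c k j = go k j j (λ _ → refl)
  where
  open ≡-Reasoning
  -- The positions separate: `i` is where the product is evaluated, `j` the one that `f` cannot tell
  -- from it.
  go : ∀ k i j → (∀ l → f (l ℕ.+ i) ≡ f (l ℕ.+ j)) →
    progressionSum (c ℕ.* a I) k (λ i → f i * g i) i ≡ g i * progressionSum c k f j
  go zero    i j eq = sym (ℤ.*-zeroʳ (g i))
  go (suc k) i j eq = begin
    f i * g i + progressionSum (c ℕ.* a I) k (λ i → f i * g i) (c ℕ.* a I ℕ.+ i)
      ≡⟨ cong ((f i * g i) +_) (go k (c ℕ.* a I ℕ.+ i) (c ℕ.+ j) next) ⟩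
    f i * g i + g (c ℕ.* a I ℕ.+ i) * progressionSum c k f (c ℕ.+ j)
      ≡⟨ cong₂ (λ x y → x * g i + y * progressionSum c k f (c ℕ.+ j)) (eq 0) (Periodic-∣ (ℕ.∣n⇒∣m*n c (d′∣a I)) perg i) ⟩
    f j * g i + g i * progressionSum c k f (c ℕ.+ j)
      ≡⟨ cong (_+ g i * progressionSum c k f (c ℕ.+ j)) (ℤ.*-comm (f j) (g i)) ⟩
    g i * f j + g i * progressionSum c k f (c ℕ.+ j)
      ≡⟨ ℤ.*-distribˡ-+ (g i) (f j) _ ⟨
    g i * (f j + progressionSum c k f (c ℕ.+ j)) ∎
    where
    swap : ∀ l x i → l ℕ.+ (x ℕ.+ i) ≡ x ℕ.+ (l ℕ.+ i)
    swap = ℕ-solve-∀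
    next : ∀ l → f (l ℕ.+ (c ℕ.* a I ℕ.+ i)) ≡ f (l ℕ.+ (c ℕ.+ j))
    next l = begin
      f (l ℕ.+ (c ℕ.* a I ℕ.+ i))    ≡⟨ cong f (swap l (c ℕ.* a I) i) ⟩
      f (c ℕ.* a I ℕ.+ (l ℕ.+ i))    ≡⟨ absorb I perf c (l ℕ.+ i) ⟩
      f (c ℕ.+ (l ℕ.+ i))            ≡⟨ cong f (ℕ.+-assoc c l i) ⟨
      f (c ℕ.+ l ℕ.+ i)              ≡⟨ eq (c ℕ.+ l) ⟩
      f (c ℕ.+ l ℕ.+ j)              ≡⟨ cong f (trans (ℕ.+-assoc c l j) (sym (swap l c j))) ⟩
      f (l ℕ.+ (c ℕ.+ j))            ∎

0<-* : ∀ {d d′} → 0 ℕ.< d → 0 ℕ.< d′ → 0 ℕ.< d ℕ.* d′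
0<-* {suc d} {suc d′} _ _ = s≤s z≤n

-- A proper divisor `c` of `d d′` is not a multiple of both `d` and `d′`. If `d` fails to divide it,
-- the sum with step `c a` is `g` times a vanishing sum of `f`; otherwise the factors change roles.
L-* : ∀ {d d′ f g} → 0 ℕ.< d → 0 ℕ.< d′ → Coprime d d′ → L d f → L d′ g → L (d ℕ.* d′) (λ j → f j * g j)
L-* {d} {d′} {f} {g} 0<d 0<d′ coprime Lf Lg = progressionSum⇒L (0<-* 0<d 0<d′)
  (λ j → cong₂ _*_ (Periodic-∣ (ℕ.m∣m*n d′) perf j) (Periodic-∣ (ℕ.n∣m*n d) perg j)) sums
  where
  perf : Periodic d f
  perf = L⇒Periodic 0<d Lf
  perg : Periodic d′ g
  perg = L⇒Periodic 0<d′ Lg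
  sums : ∀ {c} → 0 ℕ.< c → c ℕ.< d ℕ.* d′ → c ∣ d ℕ.* d′ →
    ∃[ s ] ∃[ k ] c ∣ s × 0 ℕ.< k × (∀ j → progressionSum s k (λ j → f j * g j) j ≡ 0ℤ)
  sums {c} 0<c c<dd′ _ with d ∣? c | d′ ∣? c
  ... | no d∤c | _ = c ℕ.* a I , d , ℕ.m∣m*n (a I) , 0<d , λ j →
      trans (progressionSum-* I perf perg c d j)
            (trans (cong (g j *_) (L⇒progressionSum c d 0<d d∤c (ℕ.m∣m*n c) Lf j)) (ℤ.*-zeroʳ (g j)))
    where
    I = idempotents 0<d 0<d′ coprime
  ... | yes _ | no d′∤c = c ℕ.* a I , d′ , ℕ.m∣m*n (a I) , 0<d′ , λ j →
      trans (progressionSum-cong (c ℕ.* a I) d′ (λ i → ℤ.*-comm (f i) (g i)) j)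
      (trans (progressionSum-* I perg perf c d′ j)
             (trans (cong (f j *_) (L⇒progressionSum c d′ 0<d′ d′∤c (ℕ.m∣m*n c) Lg j)) (ℤ.*-zeroʳ (f j))))
    where
    I = idempotents 0<d′ 0<d (Coprimality.sym coprime)
  ... | yes d∣c | yes d′∣c = contradiction (ℕ.∣⇒≤ {{ℕ.>-nonZero 0<c}} (coprime-*∣ coprime d∣c d′∣c)) (ℕ.<⇒≱ c<dd′)

-- Sums of the subsequence with step `c` are sums of `h` with step `a c`. They vanish because `a` is
-- invertible modulo `d` and `0 < c < d`, so `d d′` does not divide `a c`.
L-restrict : ∀ {d d′ h} (I : Idempotents d d′) → 0 ℕ.< d → 0 ℕ.< d′ → L (d ℕ.* d′) h →
  ∀ i → L d (λ j → h (i ℕ.+ a I ℕ.* j))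
L-restrict {d} {d′} {h} I 0<d 0<d′ Lh i = progressionSum⇒L 0<d periodic sums
  where
  dd′∣da : d ℕ.* d′ ∣ d ℕ.* a I
  dd′∣da = ℕ.*-monoʳ-∣ d (d′∣a I)
  regroup : ∀ i a c j → i ℕ.+ a ℕ.* (c ℕ.+ j) ≡ a ℕ.* c ℕ.+ (i ℕ.+ a ℕ.* j)
  regroup = ℕ-solve-∀
  periodic : Periodic d (λ j → h (i ℕ.+ a I ℕ.* j))
  periodic j = trans (cong h (regroup i (a I) d j))
    (Periodic-∣ (subst (d ℕ.* d′ ∣_) (ℕ.*-comm d (a I)) dd′∣da) (L⇒Periodic (0<-* 0<d 0<d′) Lh) (i ℕ.+ a I ℕ.* j))
  reindex : ∀ c k j → progressionSum c k (λ j → h (i ℕ.+ a I ℕ.* j)) j ≡ progressionSum (a I ℕ.* c) k h (i ℕ.+ a I ℕ.* j)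
  reindex c zero    j = refl
  reindex c (suc k) j = cong (h (i ℕ.+ a I ℕ.* j) +_)
    (trans (reindex c k (c ℕ.+ j)) (cong (progressionSum (a I ℕ.* c) k h) (regroup i (a I) c j)))
  d∣ac⇒d∣c : ∀ {c} → d ∣ a I ℕ.* c → d ∣ c
  d∣ac⇒d∣c {c} d∣ac = ℕ.∣m+n∣m⇒∣n
    (subst (d ∣_) (trans (sym (ℕ.*-distribʳ-+ c (a I) (b I))) (trans (cong (ℕ._* c) (a+b≡1 I)) (lemma (q I) d d′ c)))
      (ℕ.∣m∣n⇒∣m+n d∣ac (ℕ.∣m⇒∣m*n c (d∣b I))))
    (ℕ.n∣m*n (q I ℕ.* d′ ℕ.* c))
    where
    lemma : ∀ q d d′ c → (1 ℕ.+ q ℕ.* (d ℕ.* d′)) ℕ.* c ≡ q ℕ.* d′ ℕ.* c ℕ.* d ℕ.+ c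
    lemma = ℕ-solve-∀
  sums : ∀ {c} → 0 ℕ.< c → c ℕ.< d → c ∣ d →
    ∃[ s ] ∃[ k ] c ∣ s × 0 ℕ.< k × (∀ j → progressionSum s k (λ j → h (i ℕ.+ a I ℕ.* j)) j ≡ 0ℤ)
  sums {c} 0<c c<d c∣d = c , d , ℕ.∣-refl , 0<d , λ j → trans (reindex c d j)
    (L⇒progressionSum (a I ℕ.* c) d (0<-* 0<d 0<d′)
      (λ dd′∣ac → ℕ.<⇒≱ c<d (ℕ.∣⇒≤ {{ℕ.>-nonZero 0<c}} (d∣ac⇒d∣c (ℕ.∣-trans (ℕ.m∣m*n d′) dd′∣ac))))
      (subst (d ℕ.* d′ ∣_) (ℕ.*-assoc d (a I) c) (ℕ.∣m⇒∣m*n c dd′∣da))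
      Lh (i ℕ.+ a I ℕ.* j))

swap-idempotents : ∀ {d d′} → Idempotents d d′ → Idempotents d′ d
swap-idempotents {d} {d′} I = record
  { a = b I ; b = a I ; q = q I ; d′∣a = d∣b I ; d∣b = d′∣a I
  ; a+b≡1 = trans (ℕ.+-comm (b I) (a I)) (trans (a+b≡1 I) (cong (λ x → 1 ℕ.+ q I ℕ.* x) (ℕ.*-comm d d′))) }

L-*-expansion : ∀ {d d′ h} (I : Idempotents d d′) → 0 ℕ.< d → 0 ℕ.< d′ → L (d ℕ.* d′) h → ∀ j →
  h j ≡ sum {φ d} (λ i → sum {φ d′} (λ i′ → h (a I ℕ.* toℕ i ℕ.+ b I ℕ.* toℕ i′) * (𝐞 d (toℕ i) j * 𝐞 d′ (toℕ i′) j)))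
L-*-expansion {d} {d′} {h} I 0<d 0<d′ Lh j = begin
  h j
    ≡⟨ Periodic-* (q I ℕ.* j) (L⇒Periodic (0<-* 0<d 0<d′) Lh) j ⟨
  h (q I ℕ.* j ℕ.* (d ℕ.* d′) ℕ.+ j)
    ≡⟨ cong h (trans (lemma (q I) j (d ℕ.* d′)) (trans (cong (ℕ._* j) (sym (a+b≡1 I))) (lemma′ (a I) (b I) j))) ⟩
  h (b I ℕ.* j ℕ.+ a I ℕ.* j)
    ≡⟨ L-expansion 0<d (L-restrict I 0<d 0<d′ Lh (b I ℕ.* j)) j ⟩
  sum {φ d} (λ i → h (b I ℕ.* j ℕ.+ a I ℕ.* toℕ i) * 𝐞 d (toℕ i) j)
    ≡⟨ sum-cong-≗ {φ d} (λ i → cong (_* 𝐞 d (toℕ i) j) (trans (cong h (ℕ.+-comm (b I ℕ.* j) (a I ℕ.* toℕ i)))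
         (L-expansion 0<d′ (L-restrict (swap-idempotents I) 0<d′ 0<d (subst (λ D → L D h) (ℕ.*-comm d d′) Lh) (a I ℕ.* toℕ i)) j))) ⟩
  sum {φ d} (λ i → sum {φ d′} (λ i′ → h (a I ℕ.* toℕ i ℕ.+ b I ℕ.* toℕ i′) * 𝐞 d′ (toℕ i′) j) * 𝐞 d (toℕ i) j)
    ≡⟨ sum-cong-≗ {φ d} (λ i → trans (*-distribʳ-sum {φ d′} (𝐞 d (toℕ i) j) (λ i′ → h (a I ℕ.* toℕ i ℕ.+ b I ℕ.* toℕ i′) * 𝐞 d′ (toℕ i′) j))
         (sum-cong-≗ {φ d′} (λ i′ → regroup (h (a I ℕ.* toℕ i ℕ.+ b I ℕ.* toℕ i′)) (𝐞 d′ (toℕ i′) j) (𝐞 d (toℕ i) j)))) ⟩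
  sum {φ d} (λ i → sum {φ d′} (λ i′ → h (a I ℕ.* toℕ i ℕ.+ b I ℕ.* toℕ i′) * (𝐞 d (toℕ i) j * 𝐞 d′ (toℕ i′) j))) ∎
  where
  open ≡-Reasoning
  lemma : ∀ q j x → q ℕ.* j ℕ.* x ℕ.+ j ≡ (1 ℕ.+ q ℕ.* x) ℕ.* j
  lemma = ℕ-solve-∀
  lemma′ : ∀ a b j → (a ℕ.+ b) ℕ.* j ≡ b ℕ.* j ℕ.+ a ℕ.* j
  lemma′ = ℕ-solve-∀
  regroup : ∀ x y z → x * y * z ≡ x * (z * y)
  regroup = solve-∀

-- Row spans

record _∈Span_ {r c} (v : Fin c → ℤ) (M : Matrix r c) : Set where
  constructor _,_
  field
    weights     : Fin r → ℤ
    combination : ∀ j → v j ≡ sum (λ i → weights i * M i j)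

open _∈Span_

row∈Span : ∀ {r c} (M : Matrix r c) i {v} → (∀ j → v j ≡ M i j) → v ∈Span M
row∈Span M i eq = 𝟙 i , λ j → trans (eq j) (sym (sum-𝟙 i (λ l → M l j)))

sum∈Span : ∀ {r c p} (M : Matrix r c) (y : Fin p → ℤ) (V : Fin p → Fin c → ℤ) {v} →
  (∀ j → v j ≡ sum (λ i → y i * V i j)) → (∀ i → V i ∈Span M) → v ∈Span M
sum∈Span {r} {c} {p} M y V eq V∈ = (λ l → sum {p} (λ i → y i * weights (V∈ i) l)) , λ j →
  trans (eq j) (trans (sum-cong-≗ {p} (λ i → cong (y i *_) (combination (V∈ i) j)))
    (sym (·-assoc {r = 1} (λ _ → y) (λ i → weights (V∈ i)) M zero j)))

Independent : ∀ {r c} → Matrix r c → Set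
Independent {r} M = ∀ (x : Fin r → ℤ) → (∀ j → sum (λ i → x i * M i j) ≡ 0ℤ) → ∀ i → x i ≡ 0ℤ

·-cancelʳ : ∀ {p r c} {M : Matrix r c} → Independent M → (U V : Matrix p r) → U · M ≈ V · M → U ≈ V
·-cancelʳ {r = r} {M = M} ind U V eq i j = ℤ.i-j≡0⇒i≡j _ _ (ind (λ l → U i l - V i l) vanishes j)
  where
  open ≡-Reasoning
  lemma : ∀ u v m → u * m ≡ (u - v) * m + v * m
  lemma = solve-∀
  vanishes : ∀ j → sum (λ l → (U i l - V i l) * M l j) ≡ 0ℤ
  vanishes j = Algebra.Properties.AbelianGroup.∙-cancelʳ ℤ.+-0-abelianGroup ((V · M) i j) _ _ (begin
    sum (λ l → (U i l - V i l) * M l j) + (V · M) i j         ≡⟨ ∑-distrib-+ {r} (λ l → (U i l - V i l) * M l j) (λ l → V i l * M l j) ⟨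
    sum (λ l → (U i l - V i l) * M l j + V i l * M l j)       ≡⟨ sum-cong-≗ {r} (λ l → lemma (U i l) (V i l) (M l j)) ⟨
    (U · M) i j                                               ≡⟨ eq i j ⟩
    (V · M) i j                                               ≡⟨ ℤ.+-identityˡ _ ⟨
    0ℤ + (V · M) i j                                          ∎)

-- Each matrix is an integral multiple of the other, `M = U N` and `N = V M`; cancelling independent
-- rows makes `U` and `V` mutually inverse.
sameSpan-∼ : ∀ {r c} {M N : Matrix r c} → Independent M → Independent N →
  (∀ i → M i ∈Span N) → (∀ i → N i ∈Span M) → M ∼ N
sameSpan-∼ {r} {c} {M} {N} indM indN M∈N N∈M = ∼-left {P = V} {M} (U , VU≈𝟙 , UV≈𝟙) (≈-sym N≈VM)
  where
  U V : Matrix r r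
  U i = weights (M∈N i)
  V i = weights (N∈M i)
  M≈UN : M ≈ U · N
  M≈UN i = combination (M∈N i)
  N≈VM : N ≈ V · M
  N≈VM i = combination (N∈M i)
  UV≈𝟙 : U · V ≈ 𝟙
  UV≈𝟙 = ·-cancelʳ indM (U · V) 𝟙 (≈-trans (·-assoc U V M) (≈-trans (·-congˡ U (≈-sym N≈VM)) (≈-trans (≈-sym M≈UN) (≈-sym (·-identityˡ M)))))
  VU≈𝟙 : V · U ≈ 𝟙
  VU≈𝟙 = ·-cancelʳ indN (V · U) 𝟙 (≈-trans (·-assoc V U N) (≈-trans (·-congˡ V (≈-sym M≈UN)) (≈-trans (≈-sym N≈VM) (≈-sym (·-identityˡ N)))))

-- Kronecker products and column permutations

sum-++ : ∀ m n (f : Fin (m ℕ.+ n) → ℤ) → sum f ≡ sum (λ i → f (i ↑ˡ n)) + sum (λ i → f (m ↑ʳ i))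
sum-++ zero    n f = sym (ℤ.+-identityˡ _)
sum-++ (suc m) n f = trans (cong (f zero +_) (sum-++ m n (f ∘ suc))) (sym (ℤ.+-assoc (f zero) _ _))

sum-combine : ∀ m n (f : Fin (m ℕ.* n) → ℤ) → sum f ≡ sum {m} (λ i → sum {n} (λ j → f (combine i j)))
sum-combine zero    n f = refl
sum-combine (suc m) n f = trans (sum-++ n (m ℕ.* n) f)
  (cong (sum {n} (λ j → f (j ↑ˡ (m ℕ.* n))) +_) (sum-combine m n (λ i → f (n ↑ʳ i))))

⊗-combine : ∀ {r c r′ c′} (M : Matrix r c) (N : Matrix r′ c′) i i′ j j′ →
  (M ⊗ N) (combine i i′) (combine j j′) ≡ M i j * N i′ j′
⊗-combine M N i i′ j j′ = cong₂ (λ x y → M (proj₁ x) (proj₁ y) * N (proj₂ x) (proj₂ y)) (Fin.remQuot-combine i i′) (Fin.remQuot-combine j j′)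

-- For a fixed column `j′` of `N` the inner sums are weights of a relation between rows of `M`,
-- hence 0. Letting `j′` vary gives relations between rows of `N`.
⊗-independent : ∀ {r c r′ c′} {M : Matrix r c} {N : Matrix r′ c′} → Independent M → Independent N → Independent (M ⊗ N)
⊗-independent {r} {c} {r′} {c′} {M} {N} indM indN x eq i =
  subst (λ l → x l ≡ 0ℤ) (Fin.combine-remQuot {r} r′ i)
    (indN (λ i′ → x (combine i₁ i′)) (λ j′ → indM (λ i → sum {r′} (λ i′ → x (combine i i′) * N i′ j′)) (λ j → vanishes j j′) i₁) i₂)
  where
  open ≡-Reasoning
  i₁ = proj₁ (remQuot {r} r′ i)
  i₂ = proj₂ (remQuot {r} r′ i)
  lemma : ∀ x n m → x * n * m ≡ x * (m * n)
  lemma = solve-∀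
  vanishes : ∀ j j′ → sum {r} (λ i → sum {r′} (λ i′ → x (combine i i′) * N i′ j′) * M i j) ≡ 0ℤ
  vanishes j j′ = begin
    sum {r} (λ i → sum {r′} (λ i′ → x (combine i i′) * N i′ j′) * M i j)
      ≡⟨ sum-cong-≗ {r} (λ i → trans (*-distribʳ-sum {r′} (M i j) (λ i′ → x (combine i i′) * N i′ j′))
           (sum-cong-≗ {r′} (λ i′ → trans (lemma (x (combine i i′)) (N i′ j′) (M i j))
             (cong (x (combine i i′) *_) (sym (⊗-combine M N i i′ j j′)))))) ⟩
    sum {r} (λ i → sum {r′} (λ i′ → x (combine i i′) * (M ⊗ N) (combine i i′) (combine j j′)))
      ≡⟨ sum-combine r r′ (λ l → x l * (M ⊗ N) l (combine j j′)) ⟨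
    sum (λ l → x l * (M ⊗ N) l (combine j j′))
      ≡⟨ eq (combine j j′) ⟩
    0ℤ ∎

permuteColumns-∼ : ∀ {r c} (M : Matrix r c) (σ τ : Fin c → Fin c) → (∀ j → σ (τ j) ≡ j) → (∀ j → τ (σ j) ≡ j) →
  M ∼ (λ i j → M i (σ j))
permuteColumns-∼ M σ τ στ τσ = ∼-right {Q = λ l j → 𝟙 l (σ j)} {M}
  ((λ l j → 𝟙 l (τ j)) ,
   (λ i j → trans (·-identityʳ (λ l j → 𝟙 l (σ j)) i (τ j)) (cong (𝟙 i) (στ j))) ,
   (λ i j → trans (·-identityʳ (λ l j → 𝟙 l (τ j)) i (σ j)) (cong (𝟙 i) (τσ j))))
  (λ i j → ·-identityʳ M i (σ j))

∣-positive : ∀ {d m} → 0 ℕ.< m → d ∣ m → 0 ℕ.< d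
∣-positive 0<m d∣m = ℕ.n≢0⇒n>0 (λ { refl → ℕ.m<n⇒n≢0 0<m (ℕ.0∣⇒≡0 d∣m) })

-- The factors are `gcd D m` and `gcd D n`. Their product divides `D` by coprimality, and `D`
-- divides it by distributing multiplication over the gcd twice.
∣-split : ∀ {m n D} → Coprime m n → D ∣ m ℕ.* n → ∃₂ λ d d′ → d ∣ m × d′ ∣ n × D ≡ d ℕ.* d′
∣-split {m} {n} {D} coprime D∣mn = d , d′ , gcd[m,n]∣n D m , gcd[m,n]∣n D n , ℕ.∣-antisym D∣dd′
    (coprime-*∣ (λ { (c∣d , c∣d′) → coprime (ℕ.∣-trans c∣d (gcd[m,n]∣n D m) , ℕ.∣-trans c∣d′ (gcd[m,n]∣n D n)) })
      (gcd[m,n]∣m D m) (gcd[m,n]∣m D n))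
  where
  d = gcd D m
  d′ = gcd D n
  D∣dn : D ∣ d ℕ.* n
  D∣dn = subst (D ∣_) (trans (sym (c*gcd[m,n]≡gcd[cm,cn] n D m)) (ℕ.*-comm n d))
    (gcd-greatest (ℕ.n∣m*n n) (subst (D ∣_) (ℕ.*-comm m n) D∣mn))
  D∣dd′ : D ∣ d ℕ.* d′
  D∣dd′ = subst (D ∣_) (sym (c*gcd[m,n]≡gcd[cm,cn] d D n)) (gcd-greatest (ℕ.n∣m*n d) D∣dn)

-- The two row lattices

module _ (m n : ℕ) .{{m≢0 : NonZero m}} .{{n≢0 : NonZero n}} (coprime : Coprime m n) where

  private
    0<m : 0 ℕ.< m
    0<m = ℕ.>-nonZero⁻¹ m
    0<n : 0 ℕ.< n
    0<n = ℕ.>-nonZero⁻¹ n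
    0<mn : 0 ℕ.< m ℕ.* n
    0<mn = 0<-* 0<m 0<n
    instance
      mn≢0 : NonZero (m ℕ.* n)
      mn≢0 = ℕ.>-nonZero 0<mn
    I : Idempotents m n
    I = idempotents 0<m 0<n coprime

    residue : (k : ℕ) .{{_ : NonZero k}} → ℕ → Fin k
    residue k j = fromℕ< (m%n<n j k)

    toℕ-residue : ∀ k .{{_ : NonZero k}} j → toℕ (residue k j) ≡ j % k
    toℕ-residue k j = Fin.toℕ-fromℕ< (m%n<n j k)

    -- The Chinese remainder bijection and its inverse: `σ` sends `j` to the column indexed by its
    -- residues modulo `m` and `n`, and `τ` reassembles `j` from them by the idempotents.
    σ τ : Fin (m ℕ.* n) → Fin (m ℕ.* n)
    σ j = combine (residue m (toℕ j)) (residue n (toℕ j))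
    τ j = residue (m ℕ.* n) (a I ℕ.* toℕ (proj₁ (remQuot {m} n j)) ℕ.+ b I ℕ.* toℕ (proj₂ (remQuot {m} n j)))

    residue-a : ∀ {d d′} .{{_ : NonZero d}} (I : Idempotents d d′) (s : Fin d) t → (a I ℕ.* toℕ s ℕ.+ b I ℕ.* t) % d ≡ toℕ s
    residue-a {d} {d′} I s t = begin
      (a I ℕ.* toℕ s ℕ.+ b I ℕ.* t) % d
        ≡⟨ %-remove-+ʳ (a I ℕ.* toℕ s ℕ.+ b I ℕ.* t) (ℕ.∣m⇒∣m*n (toℕ s) (d∣b I)) ⟨
      (a I ℕ.* toℕ s ℕ.+ b I ℕ.* t ℕ.+ b I ℕ.* toℕ s) % d
        ≡⟨ cong (_% d) (trans (lemma (a I) (b I) (toℕ s) t) (trans (cong (λ x → x ℕ.* toℕ s ℕ.+ b I ℕ.* t) (a+b≡1 I)) (lemma′ (q I) d d′ (toℕ s) (b I ℕ.* t)))) ⟩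
      (toℕ s ℕ.+ (q I ℕ.* d′ ℕ.* toℕ s ℕ.* d ℕ.+ b I ℕ.* t)) % d
        ≡⟨ %-remove-+ʳ (toℕ s) (ℕ.∣m∣n⇒∣m+n (ℕ.n∣m*n (q I ℕ.* d′ ℕ.* toℕ s)) (ℕ.∣m⇒∣m*n t (d∣b I))) ⟩
      toℕ s % d
        ≡⟨ m<n⇒m%n≡m (Fin.toℕ<n s) ⟩
      toℕ s ∎
      where
      open ≡-Reasoning
      lemma : ∀ a b s t → a ℕ.* s ℕ.+ b ℕ.* t ℕ.+ b ℕ.* s ≡ (a ℕ.+ b) ℕ.* s ℕ.+ b ℕ.* t
      lemma = ℕ-solve-∀
      lemma′ : ∀ q d d′ s u → (1 ℕ.+ q ℕ.* (d ℕ.* d′)) ℕ.* s ℕ.+ u ≡ s ℕ.+ (q ℕ.* d′ ℕ.* s ℕ.* d ℕ.+ u)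
      lemma′ = ℕ-solve-∀

    στ : ∀ j → σ (τ j) ≡ j
    στ j = trans (cong₂ combine (Fin.toℕ-injective first) (Fin.toℕ-injective second)) (Fin.combine-remQuot {m} n j)
      where
      s = proj₁ (remQuot {m} n j)
      t = proj₂ (remQuot {m} n j)
      x = a I ℕ.* toℕ s ℕ.+ b I ℕ.* toℕ t
      first : toℕ (residue m (toℕ (τ j))) ≡ toℕ s
      first = trans (toℕ-residue m (toℕ (τ j))) (trans (cong (_% m) (toℕ-residue (m ℕ.* n) x))
        (trans (m∣n⇒o%n%m≡o%m m (m ℕ.* n) x (ℕ.m∣m*n n)) (residue-a I s (toℕ t))))
      second : toℕ (residue n (toℕ (τ j))) ≡ toℕ t
      second = trans (toℕ-residue n (toℕ (τ j))) (trans (cong (_% n) (toℕ-residue (m ℕ.* n) x))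
        (trans (m∣n⇒o%n%m≡o%m n (m ℕ.* n) x (ℕ.n∣m*n m))
          (trans (cong (_% n) (ℕ.+-comm (a I ℕ.* toℕ s) (b I ℕ.* toℕ t))) (residue-a (swap-idempotents I) t (toℕ s)))))

    τσ : ∀ j → τ (σ j) ≡ j
    τσ j = Fin.toℕ-injective (begin
      toℕ (τ (σ j))
        ≡⟨ toℕ-residue (m ℕ.* n) _ ⟩
      (a I ℕ.* toℕ (proj₁ (remQuot {m} n (σ j))) ℕ.+ b I ℕ.* toℕ (proj₂ (remQuot {m} n (σ j)))) % (m ℕ.* n)
        ≡⟨ cong (λ st → (a I ℕ.* toℕ (proj₁ st) ℕ.+ b I ℕ.* toℕ (proj₂ st)) % (m ℕ.* n)) (Fin.remQuot-combine (residue m x) (residue n x)) ⟩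
      (a I ℕ.* toℕ (residue m x) ℕ.+ b I ℕ.* toℕ (residue n x)) % (m ℕ.* n)
        ≡⟨ cong₂ (λ s t → (a I ℕ.* s ℕ.+ b I ℕ.* t) % (m ℕ.* n)) (toℕ-residue m x) (toℕ-residue n x) ⟩
      (a I ℕ.* (x % m) ℕ.+ b I ℕ.* (x % n)) % (m ℕ.* n)
        -- Multiples of `m n` are added to complete both remainders to `x`; they are such multiples
        -- because `n ∣ a` and `m ∣ b`.
        ≡⟨ %-remove-+ʳ (a I ℕ.* (x % m) ℕ.+ b I ℕ.* (x % n)) (ℕ.∣m∣n⇒∣m+n ma nb) ⟨
      (a I ℕ.* (x % m) ℕ.+ b I ℕ.* (x % n) ℕ.+ (m ℕ.* a I ℕ.* (x ℕ./ m) ℕ.+ n ℕ.* b I ℕ.* (x ℕ./ n))) % (m ℕ.* n)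
        ≡⟨ cong (_% (m ℕ.* n)) (lemma (a I) (b I) (x % m) (x % n) (x ℕ./ m) (x ℕ./ n) m n) ⟩
      (a I ℕ.* (x % m ℕ.+ x ℕ./ m ℕ.* m) ℕ.+ b I ℕ.* (x % n ℕ.+ x ℕ./ n ℕ.* n)) % (m ℕ.* n)
        ≡⟨ cong₂ (λ s t → (a I ℕ.* s ℕ.+ b I ℕ.* t) % (m ℕ.* n)) (m≡m%n+[m/n]*n x m) (m≡m%n+[m/n]*n x n) ⟨
      (a I ℕ.* x ℕ.+ b I ℕ.* x) % (m ℕ.* n)
        ≡⟨ cong (_% (m ℕ.* n)) (trans (sym (ℕ.*-distribʳ-+ x (a I) (b I))) (cong (ℕ._* x) (a+b≡1 I))) ⟩
      (x ℕ.+ q I ℕ.* (m ℕ.* n) ℕ.* x) % (m ℕ.* n)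
        ≡⟨ %-remove-+ʳ x {d = m ℕ.* n} (ℕ.∣m⇒∣m*n x (ℕ.n∣m*n (q I))) ⟩
      x % (m ℕ.* n)
        ≡⟨ m<n⇒m%n≡m (Fin.toℕ<n j) ⟩
      x ∎)
      where
      open ≡-Reasoning
      x = toℕ j
      ma : m ℕ.* n ∣ m ℕ.* a I ℕ.* (x ℕ./ m)
      ma = ℕ.∣m⇒∣m*n (x ℕ./ m) (ℕ.*-monoʳ-∣ m (d′∣a I))
      nb : m ℕ.* n ∣ n ℕ.* b I ℕ.* (x ℕ./ n)
      nb = ℕ.∣m⇒∣m*n (x ℕ./ n) (subst (_∣ n ℕ.* b I) (ℕ.*-comm n m) (ℕ.*-monoʳ-∣ n (d∣b I)))
      lemma : ∀ a b r s u v m n → a ℕ.* r ℕ.+ b ℕ.* s ℕ.+ (m ℕ.* a ℕ.* u ℕ.+ n ℕ.* b ℕ.* v) ≡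
        a ℕ.* (r ℕ.+ u ℕ.* m) ℕ.+ b ℕ.* (s ℕ.+ v ℕ.* n)
      lemma = ℕ-solve-∀

  -- After the permutation both factors of an entry are taken at the same exponent, so the rows are
  -- pointwise products of sequences.
  permutedKronecker : Matrix (m ℕ.* n) (m ℕ.* n)
  permutedKronecker i j = (A m ⊗ A n) i (σ j)

  permutedKronecker-entry : ∀ i i′ j → permutedKronecker (combine i i′) j ≡ row m i (toℕ j) * row n i′ (toℕ j)
  permutedKronecker-entry i i′ j = trans (⊗-combine (A m) (A n) i i′ (residue m (toℕ j)) (residue n (toℕ j)))
    (cong₂ _*_ (entry 0<m i) (entry 0<n i′))
    where
    entry : ∀ {k} .{{_ : NonZero k}} → 0 ℕ.< k → ∀ i → A k i (residue k (toℕ j)) ≡ row k i (toℕ j)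
    entry {k} 0<k i = trans (cong (row k i) (toℕ-residue k (toℕ j))) (Periodic-% {h = row k i} (row-periodic 0<k i) (toℕ j))

  kronecker-∼-permuted : A m ⊗ A n ∼ permutedKronecker
  kronecker-∼-permuted = permuteColumns-∼ (A m ⊗ A n) σ τ στ τσ

  permutedKronecker-independent : Independent permutedKronecker
  permutedKronecker-independent x eq = ⊗-independent {M = A m} {A n} (A-independent 0<m) (A-independent 0<n) x
    (λ l → trans (sum-cong-≗ {m ℕ.* n} (λ i → cong (λ l → x i * (A m ⊗ A n) i l) (sym (στ l)))) (eq (τ l)))

  -- A row is a product of sequences from `L d` and `L d′`, hence lies in `L (d d′)`, and the basis
  -- of that kernel occurs among the rows of `A (m n)`.
  permutedKronecker∈Span : ∀ i → permutedKronecker i ∈Span A (m ℕ.* n)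
  permutedKronecker∈Span i = sum∈Span (A (m ℕ.* n)) (λ l → h (toℕ l)) (λ l j → 𝐞 (d ℕ.* d′) (toℕ l) (toℕ j))
      (λ j → trans (trans (cong (λ i → permutedKronecker i j) (sym (Fin.combine-remQuot {m} n i))) (permutedKronecker-entry i₁ i₂ j))
                   (L-expansion {h = h} (0<-* 0<d 0<d′) Lh (toℕ j)))
      (λ l → let r , eq = 𝐞-row 0<mn (ℕ.*-pres-∣ d∣m d′∣n) (Fin.toℕ<n l)
             in row∈Span (A (m ℕ.* n)) r (λ j → sym (eq (toℕ j))))
    where
    i₁ = proj₁ (remQuot {m} n i)
    i₂ = proj₂ (remQuot {m} n i)
    d = proj₁ (row∈L 0<m i₁)
    d′ = proj₁ (row∈L 0<n i₂)
    0<d = proj₁ (proj₂ (row∈L 0<m i₁))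
    0<d′ = proj₁ (proj₂ (row∈L 0<n i₂))
    d∣m = proj₁ (proj₂ (proj₂ (row∈L 0<m i₁)))
    d′∣n = proj₁ (proj₂ (proj₂ (row∈L 0<n i₂)))
    h : Seq
    h j = row m i₁ j * row n i₂ j
    Lh : L (d ℕ.* d′) h
    Lh = L-* {f = row m i₁} {row n i₂} 0<d 0<d′
      (λ { (c∣d , c∣d′) → coprime (ℕ.∣-trans c∣d d∣m , ℕ.∣-trans c∣d′ d′∣n) })
      (proj₂ (proj₂ (proj₂ (row∈L 0<m i₁)))) (proj₂ (proj₂ (proj₂ (row∈L 0<n i₂))))

  L-*∈Span : ∀ {d d′} → d ∣ m → d′ ∣ n → (h : Seq) → L (d ℕ.* d′) h → (λ j → h (toℕ j)) ∈Span permutedKronecker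
  L-*∈Span {d} {d′} d∣m d′∣n h Lh =
    -- The double sum is taken apart in two layers; the outer one has unit weights, as all
    -- coefficients sit in the inner one.
    sum∈Span {p = φ d} permutedKronecker (λ _ → 1ℤ)
      (λ l j → sum {φ d′} (λ l′ → h (a I′ ℕ.* toℕ l ℕ.+ b I′ ℕ.* toℕ l′) * (𝐞 d (toℕ l) (toℕ j) * 𝐞 d′ (toℕ l′) (toℕ j))))
      (λ j → trans (L-*-expansion {h = h} I′ 0<d 0<d′ Lh (toℕ j)) (sum-cong-≗ {φ d} (λ l → sym (ℤ.*-identityˡ _))))
      (λ l → sum∈Span {p = φ d′} permutedKronecker (λ l′ → h (a I′ ℕ.* toℕ l ℕ.+ b I′ ℕ.* toℕ l′))
        (λ l′ j → 𝐞 d (toℕ l) (toℕ j) * 𝐞 d′ (toℕ l′) (toℕ j)) (λ j → refl)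
        (λ l′ → let r , eq = 𝐞-row 0<m d∣m (Fin.toℕ<n l)
                    r′ , eq′ = 𝐞-row 0<n d′∣n (Fin.toℕ<n l′)
                in row∈Span permutedKronecker (combine r r′)
                     (λ j → sym (trans (permutedKronecker-entry r r′ j) (cong₂ _*_ (eq (toℕ j)) (eq′ (toℕ j)))))))
    where
    0<d = ∣-positive 0<m d∣m
    0<d′ = ∣-positive 0<n d′∣n
    I′ : Idempotents d d′
    I′ = idempotents 0<d 0<d′ (λ { (c∣d , c∣d′) → coprime (ℕ.∣-trans c∣d d∣m , ℕ.∣-trans c∣d′ d′∣n) })

  A∈Span : ∀ i → A (m ℕ.* n) i ∈Span permutedKronecker
  A∈Span i =
    let D , _ , D∣mn , LD = row∈L 0<mn i
        d , d′ , d∣m , d′∣n , D≡dd′ = ∣-split coprime D∣mn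
    in L-*∈Span d∣m d′∣n (row (m ℕ.* n) i) (subst (λ D → L D (row (m ℕ.* n) i)) D≡dd′ LD)

  kronecker-∼ : A m ⊗ A n ∼ A (m ℕ.* n)
  kronecker-∼ = ∼-trans kronecker-∼-permuted
    (sameSpan-∼ permutedKronecker-independent (A-independent 0<mn) permutedKronecker∈Span A∈Span)

theorem2p4 : (m n : ℕ) .{{_ : NonZero m}} .{{_ : NonZero n}} → Coprime m n →
    ∃[ D ] (S[ A m ⊗ A n ]≈ D) × (S[ A (m ℕ.* n) ]≈ D)
theorem2p4 m n coprime = smith-∼ (kronecker-∼ m n coprime)
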